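{- If an equation $\varepsilon$ fails in $\mathsf{DLPG}$, then it also fails in some compatible surjection for $\varepsilon$.
   Context: $\mathsf{DLPG}$ is the variety of distributive lattice-ordered pregroups, i.e. algebras $(A,\wedge,\vee,\cdot,1,^{\ell},^{r})$ with a distributive lattice reduct and a monoid reduct whose multiplication is order-preserving, satisfying $x^{\ell}x\leq 1\leq xx^{\ell}$ and $xx^{r}\leq 1\leq x^{r}x$. Write $x^{(0)}=x$, $x^{(m)}=x^{\ell^m}$ and $x^{(-m)}=x^{r^m}$ for $m\in\mathbb{Z}^+$. An equation $\varepsilon$ over variables $x_1,\ldots,x_n$ is in intentional form if it is $1\leq w_1\vee\cdots\vee w_k$, where each $w_j$ is a (possibly empty, i.e. equal to $1$) product of terms $x_i^{(m)}$; every equation is equivalent over $\mathsf{DLPG}$ to one in intentional form, and $\varepsilon$ is assumed to be in this form. Terms are taken in the language of intentional terms (multiplication, $1$, and the iterated inverses $x_i^{(m)}$) expanded by two constants $+$ and $-$ (which in an integral chain are interpreted as the successor and predecessor maps). $FS_\varepsilon$ is the set of final subwords of $\varepsilon$: all $u$ with $w_j=vu$ for some $j$ and some $v$ (so $1\in FS_\varepsilon$). For a variable $x$, $m\in\mathbb{N}$ and $v\in FS_\varepsilon$, let $\Delta^v_{x,m}=\{v\}\cup\bigcup_{j=0}^m\{\sigma_jx^{(j)}\cdots\sigma_mx^{(m)}v:\sigma_j,\ldots,\sigma_m\in\{ -1,0\},\sigma_0=0\}$ and $\Delta^v_{x,-m}=\{v\}\cup\bigcup_{j=0}^m\{\sigma_jx^{(-j)}\cdots\sigma_mx^{(-m)}v:\sigma_j,\ldots,\sigma_m\in\{1,0\},\sigma_0=0\}$,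 where $\sigma=-1$ means multiplying by the constant $-$, $\sigma=1$ multiplying by the constant $+$, and $\sigma=0$ means no factor. Let $S_\varepsilon=\{(i,m,v): i\in\{1,\ldots,n\}, m\in\mathbb{Z}, v\in FS_\varepsilon, x_i^{(m)}v\in FS_\varepsilon\}$ and $\Delta_\varepsilon=\{1\}\cup\bigcup_{(i,m,v)\in S_\varepsilon}\Delta^v_{x_i,m}$ (a finite set). A c-chain is a triple $(\Delta,\leq,\lessdot)$ where $(\Delta,\leq)$ is a finite chain and $\lessdot$ is a subset of its covering relation $\prec$ (a set of designated covering pairs). For an order-preserving partial function $g$ on a c-chain, $g^{[\ell]}$ is the relation with $(x,b)\in g^{[\ell]}$ iff $b\in Dom(g)$ and there is $a\in Dom(g)$ with $a\lessdot b$ and $g(a)<x\leq g(b)$; and $g^{[r]}$ is the relation with $(x,a)\in g^{[r]}$ iff $a\in Dom(g)$ and there is $b\in Dom(g)$ with $a\lessdot b$ and $g(a)\leq x<g(b)$ (these are order-preserving partial functions). Set $g^{[0]}=g$, $g^{[k+1]}=(g^{[k]})^{[\ell]}$, $g^{[-(k+1)]}=(g^{[-k]})^{[r]}$. A compatible surjection for $\varepsilon$ is an onto map $\varphi:\Delta_\varepsilon\to\mathbb{N}_q=\{1,\ldots,q\}$ (natural order) such that: (i) for each $i$, $g_i:=\{(\varphi(u),\varphi(x_iu)): u,x_iu\in\Delta_\varepsilon\}$ is an order-preserving partial function on $\mathbb{N}_q$; (ii) the relation $\lessdot:=\{(\varphi(v),\varphi(+v)): v,+v\in\Delta_\varepsilon\}\cup\{(\varphi(-v),\varphi(v)):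 v,-v\in\Delta_\varepsilon\}$ is contained in the covering relation $\prec$ of $\mathbb{N}_q$; (iii) $\varphi(x_i^{(m)}u)=g_i^{[m]}(\varphi(u))$ whenever $i\in\{1,\ldots,n\}$, $m\in\mathbb{Z}$ and $u,x_i^{(m)}u\in\Delta_\varepsilon$, where $g_i^{[m]}$ is computed in the c-chain $(\mathbb{N}_q,\leq,\lessdot)$. The equation $\varepsilon$ fails in $\varphi$ if $\varphi(w_1),\ldots,\varphi(w_k)<\varphi(1)$. -}

module Defs where

open import Level using (Level) renaming (suc to lsuc)
open import Data.Nat as ℕ using (ℕ; zero; suc; _≤_; _<_)
open import Data.Nat using () renaming (_∸_ to _∸ℕ_)
open import Data.Integer as ℤ using (ℤ; +_; -[1+_])
open import Data.Fin using (Fin)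
open import Data.Bool using (Bool; true; false)
open import Data.List using (List; []; _∷_; _++_; map)
open import Data.List.NonEmpty using (List⁺; toList; foldr₁) renaming (map to map⁺)
open import Data.List.Relation.Unary.Any using (Any)
open import Data.List.Relation.Unary.All using (All)
open import Data.Product using (Σ; ∃; _×_; _,_)
open import Data.Sum using (_⊎_)
open import Relation.Binary.PropositionalEquality using (_≡_)
open import Relation.Nullary using (¬_)
import Algebra.Lattice.Structures as LS
import Algebra.Structures as AS

record DLPG (c : Level) : Set (lsuc c) where
  infixr 7 _·_
  infixr 6 _∧_
  infixr 5 _∨_
  infix 4 _≤ᴬ_
  field
    Carrier : Set c
    _∧_ _∨_ _·_ : Carrier → Carrier → Carrier
    𝟙 : Carrier
    _ˡ _ʳ : Carrier → Carrier
    isDistributiveLattice : LS.IsDistributiveLattice (_≡_ {A = Carrier}) _∨_ _∧_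
    isMonoid : AS.IsMonoid (_≡_ {A = Carrier}) _·_ 𝟙

  _≤ᴬ_ : Carrier → Carrier → Set c
  x ≤ᴬ y = x ∧ y ≡ x

  field
    ·-monoˡ : ∀ {x y} z → x ≤ᴬ y → z · x ≤ᴬ z · y
    ·-monoʳ : ∀ {x y} z → x ≤ᴬ y → x · z ≤ᴬ y · z
    ˡ-contract : ∀ x → (x ˡ) · x ≤ᴬ 𝟙
    ˡ-expand   : ∀ x → 𝟙 ≤ᴬ x · (x ˡ)
    ʳ-contract : ∀ x → x · (x ʳ) ≤ᴬ 𝟙
    ʳ-expand   : ∀ x → 𝟙 ≤ᴬ (x ʳ) · x

-- Intentional terms and equations in intentional form over x_1..x_n
-- (variables indexed by Fin n).  A letter (i , m) stands for x_i^{(m)}.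

ILetter : ℕ → Set
ILetter n = Fin n × ℤ

-- an intentional word (product of letters; [] is the constant 1)
IWord : ℕ → Set
IWord n = List (ILetter n)

-- an equation in intentional form 1 ≤ w_1 ∨ ... ∨ w_k  (k ≥ 1)
Equation : ℕ → Set
Equation n = List⁺ (IWord n)

module _ {c} (A : DLPG c) where
  open DLPG A

  iterˡ : ℕ → Carrier → Carrier
  iterˡ zero a = a
  iterˡ (suc k) a = iterˡ k a ˡ

  iterʳ : ℕ → Carrier → Carrier
  iterʳ zero a = a
  iterʳ (suc k) a = iterʳ k a ʳ

  pow : ℤ → Carrier → Carrier
  pow (+ k) a = iterˡ k a
  pow -[1+ k ] a = iterʳ (suc k) a

  evalWord : ∀ {n} → (Fin n → Carrier) → IWord n → Carrier
  evalWord val [] = 𝟙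
  evalWord val ((i , m) ∷ w) = pow m (val i) · evalWord val w

  HoldsIn : ∀ {n} → Equation n → (Fin n → Carrier) → Set c
  HoldsIn ε val = 𝟙 ≤ᴬ foldr₁ _∨_ (map⁺ (evalWord val) ε)

data Letter (n : ℕ) : Set where
  var   : Fin n → ℤ → Letter n
  plus  : Letter n
  minus : Letter n

Word : ℕ → Set
Word n = List (Letter n)

embed : ∀ {n} → IWord n → Word n
embed = map (λ { (i , m) → var i m })

module _ {n : ℕ} (ε : Equation n) where

  FS : Word n → Set
  FS u = Any (λ w → Σ (Word n) λ v → embed w ≡ v ++ u) (toList ε)

block : ∀ {n} → Fin n → Letter n → (ℕ → ℤ) → (ℕ → Bool) → ℕ → ℕ → Word n
block i s e σ t zero = []
block i s e σ t (suc c) = sgn (σ t) ++ (var i (e t) ∷ block i s e σ (suc t) c)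
  where
  sgn : Bool → Word _
  sgn true = s ∷ []
  sgn false = []

ΔBlock : ∀ {n} → Fin n → Letter n → (ℕ → ℤ) → ℕ → Word n → Word n → Set
ΔBlock i s e k v u =
  u ≡ v ⊎
  Σ ℕ λ j → Σ (ℕ → Bool) λ σ →
    j ≤ k × σ 0 ≡ false × u ≡ block i s e σ j (suc (k ∸ℕ j)) ++ v

Δxm : ∀ {n} → Fin n → ℤ → Word n → Word n → Set
Δxm i (+ k)    v u = ΔBlock i minus (λ t → + t) k v u
Δxm i -[1+ k ] v u = ΔBlock i plus (λ t → ℤ.- (+ t)) (suc k) v u

InΔ : ∀ {n} → Equation n → Word n → Set
InΔ {n} ε u =
  u ≡ [] ⊎
  Σ (Fin n) λ i → Σ ℤ λ m → Σ (Word n) λ v →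
    FS ε v × FS ε (var i m ∷ v) × Δxm i m v u

-- c-chains on ℕ_q: relations on ℕ represent (graphs of) partial functions,
-- R a b meaning g(a) = b.

Rel : Set₁
Rel = ℕ → ℕ → Set

OrderPreservingPartialFunction : Rel → Set
OrderPreservingPartialFunction R =
  (∀ {a b b′} → R a b → R a b′ → b ≡ b′) ×
  (∀ {a a′ b b′} → R a b → R a′ b′ → a ≤ a′ → b ≤ b′)

_^[ℓ]_ : Rel → Rel → Rel
(g ^[ℓ] ⋖) x b = Σ ℕ λ a → Σ ℕ λ ga → Σ ℕ λ gb →
  g a ga × g b gb × ⋖ a b × ga < x × x ≤ gb

_^[r]_ : Rel → Rel → Rel
(g ^[r] ⋖) x a = Σ ℕ λ b → Σ ℕ λ ga → Σ ℕ λ gb →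
  g a ga × g b gb × ⋖ a b × ga ≤ x × x < gb

iterL : Rel → Rel → ℕ → Rel
iterL ⋖ g zero = g
iterL ⋖ g (suc k) = iterL ⋖ g k ^[ℓ] ⋖

iterR : Rel → Rel → ℕ → Rel
iterR ⋖ g zero = g
iterR ⋖ g (suc k) = iterR ⋖ g k ^[r] ⋖

iterZ : Rel → Rel → ℤ → Rel
iterZ ⋖ g (+ k) = iterL ⋖ g k
iterZ ⋖ g -[1+ k ] = iterR ⋖ g (suc k)

-- Compatible surjections.  φ is given as a total map Word n → ℕ of which
-- only the restriction to Δ_ε matters.

module _ {n : ℕ} (ε : Equation n) (q : ℕ) (φ : Word n → ℕ) where

  x⁰ : Fin n → Letter n
  x⁰ i = var i (+ 0)

  gRel : Fin n → Rel
  gRel i a b = Σ (Word n) λ u →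
    InΔ ε u × InΔ ε (x⁰ i ∷ u) × φ u ≡ a × φ (x⁰ i ∷ u) ≡ b

  ⋖Rel : Rel
  ⋖Rel a b =
    (Σ (Word n) λ v → InΔ ε v × InΔ ε (plus ∷ v) × φ v ≡ a × φ (plus ∷ v) ≡ b)
    ⊎
    (Σ (Word n) λ v → InΔ ε v × InΔ ε (minus ∷ v) × φ (minus ∷ v) ≡ a × φ v ≡ b)

  record IsCompatibleSurjection : Set where
    field
      into  : ∀ u → InΔ ε u → 1 ≤ φ u × φ u ≤ q
      onto  : ∀ k → 1 ≤ k → k ≤ q → Σ (Word n) λ u → InΔ ε u × φ u ≡ k
      g-opf : ∀ i → OrderPreservingPartialFunction (gRel i)
      ⋖-cov : ∀ {a b} → ⋖Rel a b → b ≡ suc a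
      adj   : ∀ i m u → InΔ ε u → InΔ ε (var i m ∷ u) →
              iterZ ⋖Rel (gRel i) m (φ u) (φ (var i m ∷ u))

  FailsIn : Set
  FailsIn = All (λ w → φ (embed w) < φ []) (toList ε)

-- At a point p of a chain, b ≤ a iff p ≤ b ʳ a, so the comparisons between finitely many elements of A
-- can be made one at a time by enlarging u = w₁ ∨ ⋯ ∨ w_k while keeping 1 ≰ u, with no representation
-- theorem and no choice of a prime filter. In a chain where all points have neighbours x^(ℓℓ) = + x −,
-- so every word in Δ is a shift by some k ∈ ℤ of an element of A. "b ≤ a + m" is decided likewise:
-- either u can be enlarged by a strict path c₁ʳ a, c₂ʳ c₁, …, bʳ c_m, or no enlargement contains one.
-- The resulting total preorder makes + and − covers by construction and satisfies the adjunctions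
-- x^(m+1) ⊣ x^(m); φ is the rank function of the words in Δ.

module Submission where

open import Defs
open import Algebra.Lattice.Structures using (IsDistributiveLattice)
open import Algebra.Structures using (IsMonoid)
open import Data.Bool using (Bool; true; false; if_then_else_)
open import Data.Empty using (⊥-elim)
open import Data.Fin as Fin using (Fin; zero; suc; toℕ; fromℕ<)
import Data.Fin.Properties as Fin
open import Data.Integer as ℤ using (ℤ; +_; -[1+_])
import Data.Integer.Properties as ℤ
open import Data.Integer.Tactic.RingSolver using (solve-∀)
open import Data.List using (List; []; _∷_; _++_; length; lookup; upTo; allFin; cartesianProduct; cartesianProductWith; concatMap)
open import Data.List.NonEmpty using (toList; foldr₁) renaming (map to map⁺; _∷_ to _∷⁺_)
import Data.List.Membership.DecPropositional as DecMembership
open import Data.List.Membership.Propositional using (_∈_; lose; find)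
open import Data.List.Membership.Propositional.Properties
import Data.List.Properties as List
open import Data.List.Relation.Unary.All as All using (All; []; _∷_)
open import Data.List.Relation.Unary.AllPairs using (AllPairs; []; _∷_)
open import Data.List.Relation.Unary.Any as Any using (Any; here; there; index)
import Data.List.Relation.Unary.Any.Properties as Any
open import Data.Nat as ℕ using (ℕ; zero; suc; _≤_; _<_; z≤n; s≤s; _∸_)
import Data.Nat.Properties as ℕ
open import Data.Product using (Σ; ∃; _×_; _,_; proj₁; proj₂)
open import Data.Sum as Sum using (_⊎_; inj₁; inj₂)
open import Data.Unit using (⊤; tt)
open import Function using (_∘_; id)
open import Level as Level using (Level)
open import Relation.Binary.Bundles using (Poset)
open import Relation.Binary.Definitions using (DecidableEquality; tri<; tri≈; tri>)
open import Relation.Binary.PropositionalEquality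
import Relation.Binary.Reasoning.PartialOrder as PosetReasoning
open import Relation.Nullary using (¬_; Dec; yes; no; does)
open import Relation.Nullary.Decidable using (map′; _×-dec_; _→-dec_; decidable-stable)

-- Order and inverses in a distributive lattice-ordered pregroup.

module Pregroup {c : Level} (A : DLPG c) where
  open DLPG A
  open IsDistributiveLattice isDistributiveLattice
    using (∨-comm; ∧-comm; ∧-assoc; ∧-absorbs-∨; ∨-absorbs-∧; ∧-distribʳ-∨)
  open IsMonoid isMonoid using (assoc; identityˡ; identityʳ)

  ≤-refl : ∀ {x} → x ≤ᴬ x
  ≤-refl {x} = trans (cong (x ∧_) (sym (∨-absorbs-∧ x x))) (∧-absorbs-∨ x (x ∧ x))

  ≤-reflexive : ∀ {x y} → x ≡ y → x ≤ᴬ y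
  ≤-reflexive refl = ≤-refl

  ≤-trans : ∀ {x y z} → x ≤ᴬ y → y ≤ᴬ z → x ≤ᴬ z
  ≤-trans {x} {y} {z} p q = begin
    x ∧ z        ≡⟨ cong (_∧ z) p ⟨
    (x ∧ y) ∧ z  ≡⟨ ∧-assoc x y z ⟩
    x ∧ (y ∧ z)  ≡⟨ cong (x ∧_) q ⟩
    x ∧ y        ≡⟨ p ⟩
    x            ∎
    where open ≡-Reasoning

  ≤-antisym : ∀ {x y} → x ≤ᴬ y → y ≤ᴬ x → x ≡ y
  ≤-antisym {x} {y} p q = trans (sym p) (trans (∧-comm x y) q)

  x≤x∨y : ∀ x y → x ≤ᴬ x ∨ y
  x≤x∨y = ∧-absorbs-∨

  y≤x∨y : ∀ x y → y ≤ᴬ x ∨ y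
  y≤x∨y x y = subst (y ≤ᴬ_) (∨-comm y x) (x≤x∨y y x)

  ∨-least : ∀ {x y z} → x ≤ᴬ z → y ≤ᴬ z → x ∨ y ≤ᴬ z
  ∨-least {x} {y} {z} p q = trans (∧-distribʳ-∨ z x y) (cong₂ _∨_ p q)

  x∧y≤y : ∀ x y → x ∧ y ≤ᴬ y
  x∧y≤y x y = trans (∧-assoc x y y) (cong (x ∧_) ≤-refl)

  x∧y≤x : ∀ x y → x ∧ y ≤ᴬ x
  x∧y≤x x y = subst (_≤ᴬ x) (∧-comm y x) (x∧y≤y y x)

  ∨-monoʳ : ∀ {x y} z → x ≤ᴬ y → z ∨ x ≤ᴬ z ∨ y
  ∨-monoʳ {x} {y} z p = ∨-least (x≤x∨y z y) (≤-trans p (y≤x∨y z y))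

  ≤-poset : Poset c c c
  ≤-poset = record
    { isPartialOrder = record
      { isPreorder = record { isEquivalence = isEquivalence ; reflexive = ≤-reflexive ; trans = ≤-trans }
      ; antisym = ≤-antisym } }

  module ≤-Reasoning = PosetReasoning ≤-poset

  ·-expandˡ : ∀ {e} t → 𝟙 ≤ᴬ e → t ≤ᴬ e · t
  ·-expandˡ {e} t p = subst (_≤ᴬ e · t) (identityˡ t) (·-monoʳ t p)

  ·-expandʳ : ∀ {e} t → 𝟙 ≤ᴬ e → t ≤ᴬ t · e
  ·-expandʳ {e} t p = subst (_≤ᴬ t · e) (identityʳ t) (·-monoˡ t p)

  ·-contractˡ : ∀ {e} t → e ≤ᴬ 𝟙 → e · t ≤ᴬ t
  ·-contractˡ {e} t p = subst (e · t ≤ᴬ_) (identityˡ t) (·-monoʳ t p)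

  ·-contractʳ : ∀ {e} t → e ≤ᴬ 𝟙 → t · e ≤ᴬ t
  ·-contractʳ {e} t p = subst (t · e ≤ᴬ_) (identityʳ t) (·-monoˡ t p)

  ·-inner : ∀ x y z t → (x · y) · (z · t) ≡ (x · (y · z)) · t
  ·-inner x y z t = begin
    (x · y) · (z · t)  ≡⟨ assoc (x · y) z t ⟨
    ((x · y) · z) · t  ≡⟨ cong (_· t) (assoc x y z) ⟩
    (x · (y · z)) · t  ∎
    where open ≡-Reasoning

  ·-contract-inner : ∀ {y z} x t → y · z ≤ᴬ 𝟙 → (x · y) · (z · t) ≤ᴬ x · t
  ·-contract-inner x t p = ≤-trans (≤-reflexive (·-inner x _ _ t)) (·-monoʳ t (·-contractʳ x p))

  ·-expand-inner : ∀ {y z} x t → 𝟙 ≤ᴬ y · z → x · t ≤ᴬ (x · y) · (z · t)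
  ·-expand-inner x t p = ≤-trans (·-monoʳ t (·-expandʳ x p)) (≤-reflexive (sym (·-inner x _ _ t)))

  -- Left multiplication by `z` has left multiplication by `z ʳ` as its right adjoint (`transpose`),
  -- so it preserves joins.
  ·-distribˡ-∨ : ∀ z x y → z · (x ∨ y) ≤ᴬ z · x ∨ z · y
  ·-distribˡ-∨ z x y = begin
    z · (x ∨ y)                    ≤⟨ ·-monoˡ z (∨-least (transpose (x≤x∨y _ _)) (transpose (y≤x∨y _ _))) ⟩
    z · (z ʳ · (z · x ∨ z · y))    ≡⟨ assoc z (z ʳ) _ ⟨
    (z · z ʳ) · (z · x ∨ z · y)    ≤⟨ ·-contractˡ _ (ʳ-contract z) ⟩
    z · x ∨ z · y                  ∎
    where
    open ≤-Reasoning
    transpose : ∀ {t s} → z · t ≤ᴬ s → t ≤ᴬ z ʳ · s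
    transpose {t} {s} p = begin
      t              ≤⟨ ·-expandˡ t (ʳ-expand z) ⟩
      (z ʳ · z) · t  ≡⟨ assoc (z ʳ) z t ⟩
      z ʳ · (z · t)  ≤⟨ ·-monoˡ (z ʳ) p ⟩
      z ʳ · s        ∎

  -- One half of the uniqueness of adjoints: `t ≤ s · y · t ≤ s`. Used in both directions it gives
  -- `ʳ-unique`.
  adjoint-compare : ∀ {s t y} → 𝟙 ≤ᴬ s · y → y · t ≤ᴬ 𝟙 → t ≤ᴬ s
  adjoint-compare {s} {t} {y} p q = begin
    t            ≤⟨ ·-expandˡ t p ⟩
    (s · y) · t  ≡⟨ assoc s y t ⟩
    s · (y · t)  ≤⟨ ·-contractʳ s q ⟩
    s            ∎
    where open ≤-Reasoning

  ʳ-unique : ∀ {y z} → y · z ≤ᴬ 𝟙 → 𝟙 ≤ᴬ z · y → z ≡ y ʳ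
  ʳ-unique {y} p q = ≤-antisym (adjoint-compare (ʳ-expand y) p) (adjoint-compare q (ʳ-contract y))

  x≡xˡʳ : ∀ x → x ≡ (x ˡ) ʳ
  x≡xˡʳ x = ʳ-unique (ˡ-contract x) (ˡ-expand x)

  x≡xʳˡ : ∀ x → x ≡ (x ʳ) ˡ
  x≡xʳˡ x = ≤-antisym (compare (ˡ-expand (x ʳ)) (ʳ-contract x)) (compare (ʳ-expand x) (ˡ-contract (x ʳ)))
    where
    compare : ∀ {s t} → 𝟙 ≤ᴬ x ʳ · s → t · x ʳ ≤ᴬ 𝟙 → t ≤ᴬ s
    compare {s} {t} p q = begin
      t              ≤⟨ ·-expandʳ t p ⟩
      t · (x ʳ · s)  ≡⟨ assoc t (x ʳ) s ⟨
      (t · x ʳ) · s  ≤⟨ ·-contractˡ s q ⟩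
      s              ∎
      where open ≤-Reasoning

  ·-ʳ : ∀ x y → y ʳ · x ʳ ≡ (x · y) ʳ
  ·-ʳ x y = ʳ-unique
    (≤-trans (·-contract-inner x (x ʳ) (ʳ-contract y)) (ʳ-contract x))
    (≤-trans (ʳ-expand y) (·-expand-inner (y ʳ) y (ʳ-expand x)))

  𝟙ʳ : 𝟙 ≡ 𝟙 ʳ
  𝟙ʳ = ʳ-unique (≤-reflexive (identityˡ 𝟙)) (≤-reflexive (sym (identityˡ 𝟙)))

  ʳ-antitone : ∀ {x y} → x ≤ᴬ y → y ʳ ≤ᴬ x ʳ
  ʳ-antitone {x} {y} p = adjoint-compare (ʳ-expand x) (≤-trans (·-monoʳ (y ʳ) p) (ʳ-contract y))

  -- The algebraic trace of linearity: at each point of a chain `x ≤ y` or `y ≤ x`. The proof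
  -- expands at `x ∨ y`, whose inverse lies below both `x ʳ` and `y ʳ`.
  ʳ-total : ∀ x y → 𝟙 ≤ᴬ x ʳ · y ∨ y ʳ · x
  ʳ-total x y = begin
    𝟙                                      ≤⟨ ʳ-expand (x ∨ y) ⟩
    (x ∨ y) ʳ · (x ∨ y)                    ≤⟨ ·-distribˡ-∨ _ x y ⟩
    (x ∨ y) ʳ · x ∨ (x ∨ y) ʳ · y          ≤⟨ ∨-least
        (≤-trans (·-monoʳ x (ʳ-antitone (y≤x∨y x y))) (y≤x∨y _ _))
        (≤-trans (·-monoʳ y (ʳ-antitone (x≤x∨y x y))) (x≤x∨y _ _)) ⟩
    x ʳ · y ∨ y ʳ · x                      ∎
    where open ≤-Reasoning

  ∧-greatest : ∀ {x y z} → z ≤ᴬ x → z ≤ᴬ y → z ≤ᴬ x ∧ y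
  ∧-greatest {x} {y} {z} p q = trans (sym (∧-assoc z x y)) (trans (cong (_∧ y) p) q)

  𝟙≤∨-truncate : ∀ {v x} → 𝟙 ≤ᴬ v ∨ x → 𝟙 ≤ᴬ v ∧ 𝟙 ∨ x ∧ 𝟙
  𝟙≤∨-truncate {v} {x} p = ≤-trans (∧-greatest p ≤-refl) (≤-reflexive (∧-distribʳ-∨ 𝟙 v x))

  -- With x′ = x ∧ 1 one has 1 ≤ v ∨ x′ ≤ v ∨ x′ (v′ ∨ y′), and x′ v′ ≤ v′.
  𝟙≤v∨-· : ∀ {v x y} → 𝟙 ≤ᴬ v ∨ x → 𝟙 ≤ᴬ v ∨ y → 𝟙 ≤ᴬ v ∨ x · y
  𝟙≤v∨-· {v} {x} {y} p q = begin
    𝟙                                        ≤⟨ 𝟙≤∨-truncate p ⟩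
    v′ ∨ x′                                  ≤⟨ ∨-monoʳ v′ (·-expandʳ x′ (𝟙≤∨-truncate q)) ⟩
    v′ ∨ x′ · (v′ ∨ y′)                      ≤⟨ ∨-monoʳ v′ (·-distribˡ-∨ x′ v′ y′) ⟩
    v′ ∨ (x′ · v′ ∨ x′ · y′)                 ≤⟨ ∨-least (≤-trans (x∧y≤x v 𝟙) (x≤x∨y v _))
        (∨-least (≤-trans (·-contractˡ v′ (x∧y≤y x 𝟙)) (≤-trans (x∧y≤x v 𝟙) (x≤x∨y v _)))
                 (≤-trans (·-monoʳ y′ (x∧y≤x x 𝟙)) (≤-trans (·-monoˡ x (x∧y≤x y 𝟙)) (y≤x∨y v _)))) ⟩
    v ∨ x · y                                ∎
    where
    open ≤-Reasoning
    v′ = v ∧ 𝟙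
    x′ = x ∧ 𝟙
    y′ = y ∧ 𝟙

  pow-suc : ∀ p a → pow A (ℤ.suc p) a ≡ (pow A p a) ˡ
  pow-suc (+ k) a = refl
  pow-suc -[1+ zero ] a = x≡xʳˡ a
  pow-suc -[1+ suc k ] a = x≡xʳˡ _

  pow-ʳ : ∀ p a → pow A p a ≡ (pow A (ℤ.suc p) a) ʳ
  pow-ʳ p a = trans (x≡xˡʳ _) (cong _ʳ (sym (pow-suc p a)))

  -- Strict paths and bounded comparisons forced by a consistent element.

  Consistent : Carrier → Set c
  Consistent v = ¬ (𝟙 ≤ᴬ v)

  -- A consistent v stands for a point p of a representing chain with v(p) < p; then
  -- y ʳ · x ≤ v forces x(p) < y(p).
  Edge : Carrier → Carrier → Carrier → Set c
  Edge v x y = y ʳ · x ≤ᴬ v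

  -- Forces `x + k ≤ y`, since each edge is worth at least one successor. The intermediate elements
  -- range over all of `A`, not only over the values of words in Δ.
  Path : Carrier → ℕ → Carrier → Carrier → Set c
  Path v zero x y = x ≡ y
  Path v (suc k) x y = ∃ λ z → Edge v x z × Path v k z y

  Path-weaken : ∀ {v w} → v ≤ᴬ w → ∀ k {x y} → Path v k x y → Path w k x y
  Path-weaken v≤w zero p = p
  Path-weaken v≤w (suc k) (z , e , p) = z , ≤-trans e v≤w , Path-weaken v≤w k p

  Path-++ : ∀ {v} j {k x y z} → Path v j x y → Path v k y z → Path v (j ℕ.+ k) x z
  Path-++ zero refl q = q
  Path-++ (suc j) (t , e , p) q = t , e , Path-++ j p q

  Path-split : ∀ {v} j {k x z} → Path v (j ℕ.+ k) x z → ∃ λ y → Path v j x y × Path v k y z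
  Path-split zero p = _ , refl , p
  Path-split (suc j) (t , e , p) with y , q , r ← Path-split j p = y , (t , e , q) , r

  Path-snoc : ∀ {v} k {x y z} → Path v k x y → Edge v y z → Path v (suc k) x z
  Path-snoc zero refl e = _ , e , refl
  Path-snoc (suc k) (t , f , p) e = t , f , Path-snoc k p e

  -- x ≤ y + z, where + counts successors. For z ≥ 0 this is the forcing negation of
  -- "y + (z + 1) ≤ x", so that it persists when u grows and no maximal (prime) u is needed.
  AtMost : Carrier → ℤ → Carrier → Carrier → Set c
  AtMost u (+ m) x y = ∀ v → u ≤ᴬ v → Consistent v → ¬ Path v (suc m) y x
  AtMost u -[1+ m ] x y = Path u (suc m) x y

  AtMost-weaken : ∀ {u v} → u ≤ᴬ v → ∀ z {x y} → AtMost u z x y → AtMost v z x y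
  AtMost-weaken u≤v (+ m) f w v≤w = f w (≤-trans u≤v v≤w)
  AtMost-weaken u≤v -[1+ m ] p = Path-weaken u≤v (suc m) p

  -- After `n` steps the path crosses an edge from `s` to `t`. An enlargement with `s` strictly
  -- below `y` would give a path of length `n + 1` from `d` to `y`, against `g`; one with `y`
  -- strictly below `t` would give a path of length `m + 1` from `y` to `x`, against `f`. Hence both
  -- enlargements are inconsistent, which amounts to `t ≤ y ≤ s` and contradicts the edge.
  Path-glue : ∀ {u m n x y d} → Consistent u →
    AtMost u (+ m) x y → AtMost u (+ n) y d → ¬ Path u (suc (m ℕ.+ n)) d x
  Path-glue {u} {m} {n} {x} {y} {d} con f g p
    with s , p₁ , t , e , p₂ ← Path-split n
      (subst (λ k → Path u k d x) (trans (cong suc (ℕ.+-comm m n)) (sym (ℕ.+-suc n m))) p) =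
    g (u ∨ y ʳ · s) (x≤x∨y _ _) (λ h₁ →
      f (u ∨ t ʳ · y) (x≤x∨y _ _) (λ h₂ → con (combine h₁ h₂))
        (t , y≤x∨y _ _ , Path-weaken (x≤x∨y _ _) m p₂))
      (Path-snoc n (Path-weaken (x≤x∨y _ _) n p₁) (y≤x∨y _ _))
    where
    combine : 𝟙 ≤ᴬ u ∨ y ʳ · s → 𝟙 ≤ᴬ u ∨ t ʳ · y → 𝟙 ≤ᴬ u
    -- The product `(t ʳ · y) · (y ʳ · s)` contracts to `t ʳ · s`, which the edge `e` puts below
    -- `u`.
    combine h₁ h₂ = ≤-trans (𝟙≤v∨-· h₂ h₁)
      (∨-least ≤-refl (≤-trans (·-contract-inner (t ʳ) s (ʳ-contract y)) e))

  i-suc-k+suc-k : ∀ i k → i ≡ i ℤ.+ -[1+ k ] ℤ.+ + suc k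
  i-suc-k+suc-k i k = identity i (+ k)
    where
    identity : ∀ i j → i ≡ i ℤ.- (+ 1 ℤ.+ j) ℤ.+ (+ 1 ℤ.+ j)
    identity = solve-∀

  i-suc-k≡-1⇒i≡k : ∀ {i k} → i ℤ.+ -[1+ k ] ≡ ℤ.-1ℤ → i ≡ + k
  i-suc-k≡-1⇒i≡k {i} {k} eq = trans (i-suc-k+suc-k i k) (cong (ℤ._+ + suc k) eq)

  acyclic₊₊₋ : ∀ {u} → Consistent u → ∀ {m n k p q r} → + m ℤ.+ + n ℤ.+ -[1+ k ] ≡ ℤ.-1ℤ →
    AtMost u (+ m) p q → AtMost u (+ n) q r → ¬ AtMost u -[1+ k ] r p
  acyclic₊₊₋ {u} con {m} {n} {k} {p} {q} {r} eq f g h =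
    Path-glue {m = m} {n = n} con f g
      (subst (λ t → Path u (suc t) r p) (sym (ℤ.+-injective (i-suc-k≡-1⇒i≡k {+ (m ℕ.+ n)} {k} eq))) h)

  acyclic₊₋₋ : ∀ {u} → Consistent u → ∀ {m n k p q r} → + m ℤ.+ -[1+ n ] ℤ.+ -[1+ k ] ≡ ℤ.-1ℤ →
    AtMost u (+ m) p q → AtMost u -[1+ n ] q r → ¬ AtMost u -[1+ k ] r p
  acyclic₊₋₋ {u} con {m} {n} {k} {p} {q} {r} eq f g h =
    f u ≤-refl con (subst (λ t → Path u t q p) size (Path-++ (suc n) g h))
    where
    m≡k+suc-n : + m ≡ + (k ℕ.+ suc n)
    m≡k+suc-n = trans (i-suc-k+suc-k (+ m) n) (cong (ℤ._+ + suc n) (i-suc-k≡-1⇒i≡k {+ m ℤ.+ -[1+ n ]} {k} eq))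
    size : suc n ℕ.+ suc k ≡ suc m
    size = trans (ℕ.+-comm (suc n) (suc k)) (cong suc (sym (ℤ.+-injective m≡k+suc-n)))

  +-rotate : ∀ a b c → b ℤ.+ c ℤ.+ a ≡ a ℤ.+ b ℤ.+ c
  +-rotate = solve-∀

  -- Going round the cycle would give `p ≤ p - 1`. A total of -1 leaves one or two of the three
  -- weights negative, and rotating the cycle reduces to `acyclic₊₊₋`, where a path is glued, or to
  -- `acyclic₊₋₋`, where two paths are concatenated.
  AtMost-acyclic : ∀ {u} → Consistent u → ∀ z w y {p q r} → z ℤ.+ w ℤ.+ y ≡ ℤ.-1ℤ →
    AtMost u z p q → AtMost u w q r → ¬ AtMost u y r p
  AtMost-acyclic con (+ m) (+ n) -[1+ k ] eq f g h = acyclic₊₊₋ con {m} {n} {k} eq f g h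
  AtMost-acyclic con (+ m) -[1+ n ] (+ k) eq f g h =
    acyclic₊₊₋ con {k} {m} {n} (trans (sym (+-rotate (+ k) (+ m) -[1+ n ])) eq) h f g
  AtMost-acyclic con -[1+ m ] (+ n) (+ k) eq f g h =
    acyclic₊₊₋ con {n} {k} {m} (trans (+-rotate -[1+ m ] (+ n) (+ k)) eq) g h f
  AtMost-acyclic con (+ m) -[1+ n ] -[1+ k ] eq f g h = acyclic₊₋₋ con {m} {n} {k} eq f g h
  AtMost-acyclic con -[1+ m ] (+ n) -[1+ k ] eq f g h =
    acyclic₊₋₋ con {n} {k} {m} (trans (+-rotate -[1+ m ] (+ n) -[1+ k ]) eq) g h f
  AtMost-acyclic con -[1+ m ] -[1+ n ] (+ k) eq f g h =
    acyclic₊₋₋ con {k} {m} {n} (trans (sym (+-rotate (+ k) -[1+ m ] -[1+ n ])) eq) h f g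

  AtMost-≤ : ∀ {u x y} → x ≤ᴬ y → AtMost u (+ 0) x y
  AtMost-≤ {x = x} x≤y v u≤v con (_ , e , refl) =
    con (≤-trans (ʳ-expand x) (≤-trans (·-monoˡ (x ʳ) x≤y) e))

  -- A counterexample is a pair of opposite edges between `x` and some `y`; they put both joinands
  -- of `ʳ-total` below `v`.
  AtMost-suc : ∀ {u} x → AtMost u (+ 1) x x
  AtMost-suc x v u≤v con (y , e , _ , f , refl) = con (≤-trans (ʳ-total y x) (∨-least e f))

  -- One alternative is a path and the other its forcing negation. If no consistent enlargement
  -- contains the path, then the negation holds at `u` itself; this case distinction is the source
  -- of the double negation.
  AtMost-decide : ∀ {u} → Consistent u → ∀ z x y →
    ¬ ¬ ∃ λ v → u ≤ᴬ v × Consistent v × (AtMost v z x y ⊎ AtMost v (ℤ.- ℤ.suc z) y x)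
  AtMost-decide {u} con (+ m) x y k =
    k (u , ≤-refl , con , inj₁ λ v u≤v con′ p → k (v , u≤v , con′ , inj₂ p))
  AtMost-decide {u} con -[1+ zero ] x y k =
    k (u , ≤-refl , con , inj₂ λ v u≤v con′ p → k (v , u≤v , con′ , inj₁ p))
  AtMost-decide {u} con -[1+ suc m ] x y k =
    k (u , ≤-refl , con , inj₂ λ v u≤v con′ p → k (v , u≤v , con′ , inj₁ p))

  -- Transport of paths along the iterated inverses of one element.

  module _ (a : Carrier) where

    infixr 8 _↑_
    _↑_ : ℤ → Carrier → Carrier
    p ↑ x = pow A p a · x

    ↑-ʳ : ∀ p x → (ℤ.suc p ↑ x) ʳ ≡ x ʳ · pow A p a
    ↑-ʳ p x = sym (trans (cong (x ʳ ·_) (pow-ʳ p a)) (·-ʳ _ x))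

    pow-contract : ∀ p → pow A (ℤ.suc p) a · pow A p a ≤ᴬ 𝟙
    pow-contract p = subst (λ t → t · pow A p a ≤ᴬ 𝟙) (sym (pow-suc p a)) (ˡ-contract _)

    pow-expand : ∀ p → 𝟙 ≤ᴬ pow A p a · pow A (ℤ.suc p) a
    pow-expand p = subst (λ t → 𝟙 ≤ᴬ pow A p a · t) (sym (pow-suc p a)) (ˡ-expand _)

    ↑-contract : ∀ p x → ℤ.suc p ↑ p ↑ x ≤ᴬ x
    ↑-contract p x = subst (_≤ᴬ x) (assoc _ _ x) (·-contractˡ x (pow-contract p))

    ↑-expand : ∀ p x → x ≤ᴬ p ↑ ℤ.suc p ↑ x
    ↑-expand p x = subst (x ≤ᴬ_) (assoc _ _ x) (·-expandˡ x (pow-expand p))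

    -- In the intended chain the power `p + 2` is the power `p` conjugated by the successor, so from
    -- `x ≤ y - 1` monotonicity yields a strict comparison again.
    Edge-↑ : ∀ {v} p {x y} → Edge v x y → Edge v (p ↑ x) (ℤ.suc (ℤ.suc p) ↑ y)
    Edge-↑ p {x} {y} e = ≤-trans
      (≤-reflexive (cong (_· p ↑ x) (↑-ʳ (ℤ.suc p) y)))
      (≤-trans (·-contract-inner (y ʳ) x (pow-contract p)) e)

    -- The contrapositive of the adjunction between consecutive powers. Both edges bound the same
    -- element, hence an equality of types.
    Edge-transpose : ∀ {v} p {x y} → Edge v (p ↑ x) y ≡ Edge v x (ℤ.suc p ↑ y)
    Edge-transpose {v} p {x} {y} = cong (_≤ᴬ v) (trans (sym (assoc (y ʳ) _ x)) (cong (_· x) (sym (↑-ʳ p y))))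

    Edge-reflect : ∀ {v} p {x y} → Edge v (p ↑ x) (p ↑ y) → Edge v x y
    Edge-reflect p {x} {y} e = ≤-trans
      (≤-trans (·-expand-inner (y ʳ) x (ʳ-expand _)) (≤-reflexive (cong (_· p ↑ x) (·-ʳ _ y)))) e

    Path-↑ : ∀ {v} m p q {x y} → q ≡ p ℤ.+ (+ m ℤ.+ + m) →
      Path v m x y → Path v m (p ↑ x) (q ↑ y)
    Path-↑ zero p q {x} eq refl = cong (_↑ x) (trans (sym (ℤ.+-identityʳ p)) (sym eq))
    Path-↑ (suc m) p q eq (z , e , h) =
      ℤ.suc (ℤ.suc p) ↑ z , Edge-↑ p e , Path-↑ m (ℤ.suc (ℤ.suc p)) q (trans eq (shift p (+ m))) h
      where
      shift : ∀ p m → p ℤ.+ (+ 1 ℤ.+ m ℤ.+ (+ 1 ℤ.+ m)) ≡ + 1 ℤ.+ (+ 1 ℤ.+ p) ℤ.+ (m ℤ.+ m)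
      shift = solve-∀

    Path-transpose : ∀ {v} m p q {x y} → q ≡ ℤ.suc p ℤ.+ (+ m ℤ.+ + m) →
      Path v (suc m) x (q ↑ y) → Path v (suc m) (p ↑ x) y
    Path-transpose {v} zero p q {x} {y} eq (_ , e , refl) =
      y , subst id (sym (Edge-transpose p {x} {y}))
            (subst (λ t → Edge v x (t ↑ y)) (trans eq (ℤ.+-identityʳ (ℤ.suc p))) e) , refl
    Path-transpose (suc m) p q {x} {y} eq (z , e , h) =
      ℤ.suc (ℤ.suc p) ↑ z , Edge-↑ p e ,
      Path-transpose m (ℤ.suc (ℤ.suc p)) q (trans eq (shift p (+ m))) h
      where
      shift : ∀ p m → + 1 ℤ.+ p ℤ.+ (+ 1 ℤ.+ m ℤ.+ (+ 1 ℤ.+ m)) ≡ + 1 ℤ.+ (+ 1 ℤ.+ (+ 1 ℤ.+ p)) ℤ.+ (m ℤ.+ m)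
      shift = solve-∀

    -- For `m > 0` the first and the last edge are transposed and account for one unit of the
    -- exponent each, while every edge between them accounts for two; so `m + 1` edges absorb `2m`.
    -- A single edge is reflected by monotonicity.
    Path-reflect : ∀ {v} m p q {x y} → q ≡ p ℤ.+ (+ m ℤ.+ + m) →
      Path v (suc m) (p ↑ x) (q ↑ y) → Path v (suc m) x y
    Path-reflect {v} zero p q {x} {y} eq (_ , e , refl) =
      y , Edge-reflect p (subst (λ t → Edge v (p ↑ x) (t ↑ y)) (trans eq (ℤ.+-identityʳ p)) e) , refl
    Path-reflect (suc m) p q eq (z , e , h) =
      ℤ.suc p ↑ z , subst id (Edge-transpose p) e ,
      Path-transpose m (ℤ.suc p) q (trans eq (shift p (+ m))) h
      where
      shift : ∀ p m → p ℤ.+ (+ 1 ℤ.+ m ℤ.+ (+ 1 ℤ.+ m)) ≡ + 1 ℤ.+ (+ 1 ℤ.+ p) ℤ.+ (m ℤ.+ m)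
      shift = solve-∀

    -- Monotonicity of the power `p`, conjugated by `z` successors into the power `p + 2z`. Negative
    -- `z` carries a path forward; for `z ≥ 0` a path refuting the conclusion is carried back.
    AtMost-↑ : ∀ {u} z p q {x y} → q ≡ p ℤ.+ (z ℤ.+ z) →
      AtMost u z x y → AtMost u z (q ↑ x) (p ↑ y)
    AtMost-↑ (+ m) p q eq f v u≤v con h = f v u≤v con (Path-reflect m p q eq h)
    AtMost-↑ -[1+ m ] p q eq h = Path-↑ (suc m) q p (trans (shift p (+ m)) (cong (ℤ._+ _) (sym eq))) h
      where
      shift : ∀ p m → p ≡ p ℤ.+ (ℤ.- (+ 1 ℤ.+ m) ℤ.+ ℤ.- (+ 1 ℤ.+ m)) ℤ.+ (+ 1 ℤ.+ m ℤ.+ (+ 1 ℤ.+ m))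
      shift = solve-∀

  -- Formal shifts of elements and the action of powers on them.

  -- (x , k) stands for the k-th successor of x, so that (x , k) ≤ (y , l) iff x ≤ y + (l − k).
  Point : Set c
  Point = Carrier × ℤ

  up down : Point → Point
  up (x , k) = x , ℤ.suc k
  down (x , k) = x , ℤ.pred k

  infix 4 _⊢_⊑_
  _⊢_⊑_ : Carrier → Point → Point → Set c
  u ⊢ (x , k) ⊑ (y , l) = AtMost u (l ℤ.- k) x y

  ⊑-weaken : ∀ {u v} → u ≤ᴬ v → ∀ p q → u ⊢ p ⊑ q → v ⊢ p ⊑ q
  ⊑-weaken u≤v (x , k) (y , l) = AtMost-weaken u≤v (l ℤ.- k)

  -- `up r ⊑ p` expresses that `r` is strictly below `p`; the levels telescope, leaving the total
  -- weight -1.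
  ⊑-acyclic : ∀ {u} → Consistent u → ∀ p q r → u ⊢ p ⊑ q → u ⊢ q ⊑ r → ¬ u ⊢ up r ⊑ p
  ⊑-acyclic con (x , k) (y , l) (z , m) =
    AtMost-acyclic con (l ℤ.- k) (m ℤ.- l) (k ℤ.- ℤ.suc m) (total k l m)
    where
    total : ∀ k l m → l ℤ.- k ℤ.+ (m ℤ.- l) ℤ.+ (k ℤ.- (+ 1 ℤ.+ m)) ≡ ℤ.- (+ 1)
    total = solve-∀

  ⊑-≤ : ∀ {u x y} k l → l ≡ k → x ≤ᴬ y → u ⊢ (x , k) ⊑ (y , l)
  ⊑-≤ {u} {x} {y} k .k refl x≤y = subst (λ z → AtMost u z x y) (sym (ℤ.+-inverseʳ k)) (AtMost-≤ x≤y)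

  ⊑-refl : ∀ {u} p → u ⊢ p ⊑ p
  ⊑-refl (x , k) = ⊑-≤ k k refl ≤-refl

  ⊑-up : ∀ {u} p → u ⊢ p ⊑ up p
  ⊑-up {u} (x , k) = subst (λ z → AtMost u z x x) (1≡suc-k-k k) (AtMost-suc x)
    where
    1≡suc-k-k : ∀ k → + 1 ≡ + 1 ℤ.+ k ℤ.- k
    1≡suc-k-k = solve-∀

  up-down : ∀ p → up (down p) ≡ p
  up-down (x , k) = cong (x ,_) (ℤ.suc-pred k)

  ⊑-decide : ∀ {u} → Consistent u → ∀ p q →
    ¬ ¬ ∃ λ v → u ≤ᴬ v × Consistent v × (v ⊢ p ⊑ q ⊎ v ⊢ up q ⊑ p)
  ⊑-decide con (x , k) (y , l) =
    subst (λ z → ¬ ¬ ∃ λ v → _ ≤ᴬ v × Consistent v × (AtMost v (l ℤ.- k) x y ⊎ AtMost v z y x))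
      (complement k l) (AtMost-decide con (l ℤ.- k) x y)
    where
    complement : ∀ k l → ℤ.- (+ 1 ℤ.+ (l ℤ.- k)) ≡ k ℤ.- (+ 1 ℤ.+ l)
    complement = solve-∀

  Decided : Carrier → Point × Point → Set c
  Decided u (p , q) = u ⊢ p ⊑ q ⊎ u ⊢ up q ⊑ p

  ⊑-decide-all : ∀ {u} → Consistent u → ∀ pqs →
    ¬ ¬ ∃ λ v → u ≤ᴬ v × Consistent v × All (Decided v) pqs
  ⊑-decide-all con [] k = k (_ , ≤-refl , con , [])
  ⊑-decide-all con ((p , q) ∷ pqs) k =
    ⊑-decide con p q λ (v , u≤v , con′ , d) →
    ⊑-decide-all con′ pqs λ (w , v≤w , con″ , ds) →
    k (w , ≤-trans u≤v v≤w , con″ , Sum.map (⊑-weaken v≤w p q) (⊑-weaken v≤w (up q) p) d ∷ ds)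

  -- In a chain where every point has a successor, x^(ℓℓ) = + x −, so x^(m) shifted k steps up is
  -- x^(m − 2k) followed by the shift.
  act : Carrier → ℤ → Point → Point
  act a m (x , k) = pow A (m ℤ.- (k ℤ.+ k)) a · x , k

  act-mono : ∀ {u} a m p q → u ⊢ p ⊑ q → u ⊢ act a m p ⊑ act a m q
  act-mono a m (x , k) (y , l) = AtMost-↑ a (l ℤ.- k) (m ℤ.- (l ℤ.+ l)) (m ℤ.- (k ℤ.+ k)) (shift m k l)
    where
    shift : ∀ m k l → m ℤ.- (k ℤ.+ k) ≡ m ℤ.- (l ℤ.+ l) ℤ.+ (l ℤ.- k ℤ.+ (l ℤ.- k))
    shift = solve-∀

  act-suc-contract : ∀ {u} a m p → u ⊢ act a (ℤ.suc m) (act a m p) ⊑ p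
  act-suc-contract a m (x , k) = ⊑-≤ k k refl
    (subst (λ z → pow A z a · pow A (m ℤ.- (k ℤ.+ k)) a · x ≤ᴬ x) (shift m k) (↑-contract a (m ℤ.- (k ℤ.+ k)) x))
    where
    shift : ∀ m k → + 1 ℤ.+ (m ℤ.- (k ℤ.+ k)) ≡ + 1 ℤ.+ m ℤ.- (k ℤ.+ k)
    shift = solve-∀

  act-suc-expand : ∀ {u} a m p → u ⊢ p ⊑ act a m (act a (ℤ.suc m) p)
  act-suc-expand a m (x , k) = ⊑-≤ k k refl
    (subst (λ z → x ≤ᴬ pow A (m ℤ.- (k ℤ.+ k)) a · pow A z a · x) (shift m k) (↑-expand a (m ℤ.- (k ℤ.+ k)) x))
    where
    shift : ∀ m k → + 1 ℤ.+ (m ℤ.- (k ℤ.+ k)) ≡ + 1 ℤ.+ m ℤ.- (k ℤ.+ k)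
    shift = solve-∀

  -- Stepping down raises the exponent of the outer power by two, so it exceeds the inner exponent
  -- by one and the contraction law applies; `up` then restores the level. In `act-up->` stepping up
  -- dually lowers it by two.
  act-down-< : ∀ {u} a m p → u ⊢ up (act a m (down (act a (ℤ.suc m) p))) ⊑ p
  act-down-< a m (x , k) = ⊑-≤ (ℤ.suc (ℤ.pred k)) k (sym (ℤ.suc-pred k))
    (subst (λ z → pow A z a · pow A (ℤ.suc m ℤ.- (k ℤ.+ k)) a · x ≤ᴬ x) (shift m k)
      (↑-contract a (ℤ.suc m ℤ.- (k ℤ.+ k)) x))
    where
    shift : ∀ m k → + 1 ℤ.+ (+ 1 ℤ.+ m ℤ.- (k ℤ.+ k)) ≡ m ℤ.- (ℤ.- (+ 1) ℤ.+ k ℤ.+ (ℤ.- (+ 1) ℤ.+ k))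
    shift = solve-∀

  act-up-> : ∀ {u} a m p → u ⊢ up p ⊑ act a (ℤ.suc m) (up (act a m p))
  act-up-> a m (x , k) = ⊑-≤ (ℤ.suc k) (ℤ.suc k) refl
    (subst₂ (λ z w → x ≤ᴬ pow A z a · pow A w a · x) (shift₁ m k) (shift₂ m k) (↑-expand a (m ℤ.- (k ℤ.+ k) ℤ.- + 1) x))
    where
    shift₁ : ∀ m k → m ℤ.- (k ℤ.+ k) ℤ.- + 1 ≡ + 1 ℤ.+ m ℤ.- (+ 1 ℤ.+ k ℤ.+ (+ 1 ℤ.+ k))
    shift₁ = solve-∀
    shift₂ : ∀ m k → + 1 ℤ.+ (m ℤ.- (k ℤ.+ k) ℤ.- + 1) ≡ m ℤ.- (k ℤ.+ k)
    shift₂ = solve-∀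

-- Rank functions of finite decidable total preorders.

record Ranking {ℓ} {X : Set} (_⊑_ : X → X → Set ℓ) (N : ℕ) : Set ℓ where
  field
    size        : ℕ
    -- The bound `N` is known before the order is, which keeps the later search space independent of
    -- the comparisons in `A`.
    size≤       : size ≤ N
    rank        : X → ℕ
    rank-pos    : ∀ x → 1 ≤ rank x
    rank≤size   : ∀ x → rank x ≤ size
    rank-onto   : ∀ k → k < size → ∃ λ x → rank x ≡ suc k
    rank-mono   : ∀ {x y} → x ⊑ y → rank x ≤ rank y
    rank-cancel : ∀ {x y} → rank x ≤ rank y → x ⊑ y

module _ {ℓ} {X : Set} (_⊑_ : X → X → Set ℓ) (⊑-trans : ∀ {x y z} → x ⊑ y → y ⊑ z → x ⊑ z)
         (total : ∀ x y → x ⊑ y ⊎ y ⊑ x) (_⊑?_ : ∀ x y → Dec (x ⊑ y)) where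

  private
    _≈_ _⊏_ : X → X → Set ℓ
    x ≈ y = x ⊑ y × y ⊑ x
    x ⊏ y = ¬ y ⊑ x

    ⊏⇒⊑ : ∀ {x y} → x ⊏ y → x ⊑ y
    ⊏⇒⊑ {x} {y} x⊏y with total x y
    ... | inj₁ p = p
    ... | inj₂ q = ⊥-elim (x⊏y q)

    -- Keeps one representative per class. The last component carries a predicate from `x` and `rs`
    -- over to the result, so that in the recursive case the head remains strictly below the new
    -- tail.
    insert : ∀ x rs → AllPairs _⊏_ rs → ∃ λ ss → AllPairs _⊏_ ss × length ss ≤ suc (length rs) ×
      Any (x ≈_) ss × (∀ {y} → Any (y ≈_) rs → Any (y ≈_) ss) ×
      (∀ {P : X → Set ℓ} → P x → All P rs → All P ss)
    insert x [] [] = x ∷ [] , [] ∷ [] , s≤s z≤n , here (⊑-refl , ⊑-refl) , there , λ p ps → p ∷ ps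
      where
      ⊑-refl : x ⊑ x
      ⊑-refl = Sum.reduce (total x x)
    insert x (r ∷ rs) (r⊏rs ∷ sorted) with x ⊑? r
    ... | no r⊏x with ss , sorted′ , len , any , incl , all ← insert x rs sorted =
      r ∷ ss , all r⊏x r⊏rs ∷ sorted′ , s≤s len , there any ,
      (λ { (here p) → here p ; (there p) → there (incl p) }) , λ { p (q ∷ qs) → q ∷ all p qs }
    ... | yes x⊑r with r ⊑? x
    ... | yes r⊑x = r ∷ rs , r⊏rs ∷ sorted , ℕ.n≤1+n _ , here (x⊑r , r⊑x) , id , λ p ps → ps
    ... | no x⊏r = x ∷ r ∷ rs , (x⊏r ∷ All.map (λ r⊏s s⊑x → r⊏s (⊑-trans s⊑x x⊑r)) r⊏rs) ∷ r⊏rs ∷ sorted ,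
      ℕ.≤-refl , here (⊑-refl , ⊑-refl) , there , λ p ps → p ∷ ps
      where
      ⊑-refl : x ⊑ x
      ⊑-refl = Sum.reduce (total x x)

    classes : ∀ xs → ∃ λ rs → AllPairs _⊏_ rs × length rs ≤ length xs × All (λ x → Any (x ≈_) rs) xs
    classes [] = [] , [] , z≤n , []
    classes (x ∷ xs)
      with rs , sorted , len , cover ← classes xs
      with ss , sorted′ , len′ , any , incl , _ ← insert x rs sorted =
      ss , sorted′ , ℕ.≤-trans len′ (s≤s len) , any ∷ All.map incl cover

    AllPairs-lookup : ∀ {rs} → AllPairs _⊏_ rs → ∀ {i j} → i Fin.< j → lookup rs i ⊏ lookup rs j
    AllPairs-lookup {rs = r ∷ rs} (r⊏rs ∷ _) {zero} {suc j} i<j = All.lookup r⊏rs (∈-lookup j)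
    AllPairs-lookup (_ ∷ sorted) {suc i} {suc j} (s≤s i<j) = AllPairs-lookup sorted i<j

  ranking : ∀ xs → (∀ x → x ∈ xs) → Ranking _⊑_ (length xs)
  ranking xs enum with rs , sorted , len , cover ← classes xs = record
    { size = length rs
    ; size≤ = len
    ; rank = λ x → suc (toℕ (pos x))
    ; rank-pos = λ x → s≤s z≤n
    ; rank≤size = λ x → Fin.toℕ<n (pos x)
    ; rank-onto = λ k k<q → lookup rs (fromℕ< k<q) , cong suc (trans (cong toℕ (onto (fromℕ< k<q))) (Fin.toℕ-fromℕ< k<q))
    ; rank-mono = λ x⊑y → s≤s (mono x⊑y)
    ; rank-cancel = λ { (s≤s p) → cancel p }
    }
    where
    class : ∀ x → Any (x ≈_) rs
    class x = All.lookup cover (enum x)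
    pos : ∀ x → Fin (length rs)
    pos x = index (class x)
    pos-≈ : ∀ x → x ≈ lookup rs (pos x)
    pos-≈ x = Any.lookup-index (class x)
    mono : ∀ {x y} → x ⊑ y → pos x Fin.≤ pos y
    mono {x} {y} x⊑y = ℕ.≮⇒≥ λ y<x →
      AllPairs-lookup sorted y<x (⊑-trans (proj₂ (pos-≈ x)) (⊑-trans x⊑y (proj₁ (pos-≈ y))))
    cancel : ∀ {x y} → pos x Fin.≤ pos y → x ⊑ y
    cancel {x} {y} p = ⊑-trans (proj₁ (pos-≈ x)) (⊑-trans (compare (ℕ.m≤n⇒m<n∨m≡n p)) (proj₂ (pos-≈ y)))
      where
      compare : toℕ (pos x) < toℕ (pos y) ⊎ toℕ (pos x) ≡ toℕ (pos y) → lookup rs (pos x) ⊑ lookup rs (pos y)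
      compare (inj₁ x<y) = ⊏⇒⊑ (AllPairs-lookup sorted x<y)
      compare (inj₂ x≡y) = subst (λ i → lookup rs (pos x) ⊑ lookup rs i) (Fin.toℕ-injective x≡y) (Sum.reduce (total _ _))
    onto : ∀ i → pos (lookup rs i) ≡ i
    onto i with Fin.<-cmp (pos (lookup rs i)) i
    ... | tri≈ _ eq _ = eq
    ... | tri< lt _ _ = ⊥-elim (AllPairs-lookup sorted lt (proj₁ (pos-≈ (lookup rs i))))
    ... | tri> _ _ gt = ⊥-elim (AllPairs-lookup sorted gt (proj₂ (pos-≈ (lookup rs i))))

-- Finite enumeration of bounded assignments.

module _ {X : Set} (_≟_ : DecidableEquality X) where

  override : X → ℕ → (X → ℕ) → X → ℕ
  override x k φ y = if does (y ≟ x) then k else φ y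

  override-elim : ∀ {p} (P : X → ℕ → Set p) {x k φ} → P x k → ∀ y → y ≡ x ⊎ P y (φ y) → P y (override x k φ y)
  override-elim P {x} p y h with y ≟ x | h
  ... | yes refl | _ = p
  ... | no y≢x | inj₁ y≡x = ⊥-elim (y≢x y≡x)
  ... | no _ | inj₂ q = q

  assignments : List X → ℕ → List (X → ℕ)
  assignments [] N = (λ _ → 0) ∷ []
  assignments (x ∷ xs) N = cartesianProductWith (override x) (upTo (suc N)) (assignments xs N)

  -- Phrased through a predicate on values, which avoids any equality of functions. A repeated entry
  -- of `xs` takes the value chosen at its first occurrence.
  assignments-complete : ∀ {p} (P : X → ℕ → Set p) N xs → All (λ x → ∃ λ k → k ≤ N × P x k) xs →
    Any (λ φ → All (λ x → P x (φ x)) xs) (assignments xs N)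
  assignments-complete P N [] [] = here []
  assignments-complete P N (x ∷ xs) ((k , k≤N , p) ∷ ps) =
    Any.cartesianProductWith⁺ (override x)
      (λ {k} {φ} p qs → override-elim P {φ = φ} p x (inj₁ refl) ∷
        All.map (λ {y} q → override-elim P {φ = φ} p y (inj₂ q)) qs)
      (lose (∈-upTo⁺ (s≤s k≤N)) p) (assignments-complete P N xs ps)

-- Enumeration of the final subwords and of Δ.

suffixes : ∀ {a} {A : Set a} → List A → List (List A)
suffixes [] = [] ∷ []
suffixes (x ∷ xs) = (x ∷ xs) ∷ suffixes xs

∈-suffixes⁺ : ∀ {a} {A : Set a} (ys : List A) {zs} → zs ∈ suffixes (ys ++ zs)
∈-suffixes⁺ [] {[]} = here refl
∈-suffixes⁺ [] {z ∷ zs} = here refl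
∈-suffixes⁺ (y ∷ ys) = there (∈-suffixes⁺ ys)

∈-suffixes⁻ : ∀ {a} {A : Set a} (xs : List A) {zs} → zs ∈ suffixes xs → ∃ λ ys → xs ≡ ys ++ zs
∈-suffixes⁻ [] (here refl) = [] , refl
∈-suffixes⁻ (x ∷ xs) (here refl) = [] , refl
∈-suffixes⁻ (x ∷ xs) (there p) with ys , refl ← ∈-suffixes⁻ xs p = x ∷ ys , refl

infixr 5 _◂_
_◂_ : Bool → (ℕ → Bool) → ℕ → Bool
(b ◂ σ) zero = b
(b ◂ σ) (suc t) = σ t

signs : ℕ → List (ℕ → Bool)
signs zero = (λ _ → false) ∷ []
signs (suc N) = cartesianProductWith _◂_ (true ∷ false ∷ []) (signs N)

-- Agreement below `N` suffices, because a block reads only finitely many signs.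
signs-complete : ∀ N (σ : ℕ → Bool) → Any (λ τ → ∀ t → t < N → τ t ≡ σ t) (signs N)
signs-complete zero σ = here λ _ ()
signs-complete (suc N) σ =
  Any.cartesianProductWith⁺ _◂_ agree (σ0∈ (σ 0)) (signs-complete N (σ ∘ suc))
  where
  agree : ∀ {b τ} → σ 0 ≡ b → (∀ t → t < N → τ t ≡ σ (suc t)) → ∀ t → t < suc N → (b ◂ τ) t ≡ σ t
  agree eq h zero _ = sym eq
  agree eq h (suc t) (s≤s t<N) = h t t<N
  σ0∈ : ∀ b → b ∈ true ∷ false ∷ []
  σ0∈ true = here refl
  σ0∈ false = there (here refl)

block-cong : ∀ {n} (i : Fin n) s e {σ τ} j c → (∀ t → j ≤ t → t < j ℕ.+ c → σ t ≡ τ t) →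
  block i s e σ j c ≡ block i s e τ j c
block-cong i s e j zero h = refl
block-cong i s e {σ} {τ} j (suc c) h
  rewrite h j ℕ.≤-refl (ℕ.m<m+n j (s≤s z≤n))
        | block-cong i s e {σ} {τ} (suc j) c (λ t j<t t< → h t (ℕ.<⇒≤ j<t) (subst (t <_) (sym (ℕ.+-suc j c)) t<)) = refl

j+[1+k∸j] : ∀ {j k} → j ≤ k → j ℕ.+ suc (k ∸ j) ≡ suc k
j+[1+k∸j] {j} {k} j≤k = trans (ℕ.+-suc j (k ∸ j)) (cong suc (ℕ.m+[n∸m]≡n j≤k))

module _ {n} (i : Fin n) (s : Letter n) (e : ℕ → ℤ) (k : ℕ) (v : Word n) where

  -- Prefixing `false` builds in the condition on the sign of index 0, leaving `k` free signs.
  blockWord : ℕ → (ℕ → Bool) → Word n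
  blockWord j σ = block i s e (false ◂ σ) j (suc (k ∸ j)) ++ v

  blocks : List (Word n)
  blocks = v ∷ cartesianProductWith blockWord (upTo (suc k)) (signs k)

  ∈-blocks⁻ : ∀ {u} → u ∈ blocks → ΔBlock i s e k v u
  ∈-blocks⁻ (here refl) = inj₁ refl
  ∈-blocks⁻ (there p)
    with j , σ , j∈ , _ , refl ← ∈-cartesianProductWith⁻ blockWord (upTo (suc k)) (signs k) p
    with s≤s j≤k ← ∈-upTo⁻ j∈ = inj₂ (j , false ◂ σ , j≤k , refl , refl)

  ∈-blocks⁺ : ∀ {u} → ΔBlock i s e k v u → u ∈ blocks
  ∈-blocks⁺ (inj₁ refl) = here refl
  ∈-blocks⁺ (inj₂ (j , σ , j≤k , σ0 , refl)) = there
    (Any.cartesianProductWith⁺ blockWord {P = j ≡_} {Q = λ τ → ∀ t → t < k → τ t ≡ σ (suc t)}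
      (λ { {_} {τ} refl h → cong (_++ v) (block-cong i s e j _ (agree τ h)) })
      (∈-upTo⁺ (s≤s j≤k)) (signs-complete k (σ ∘ suc)))
    where
    agree : ∀ τ → (∀ t → t < k → τ t ≡ σ (suc t)) → ∀ t → j ≤ t → t < j ℕ.+ suc (k ∸ j) → σ t ≡ (false ◂ τ) t
    agree τ h zero _ _ = σ0
    agree τ h (suc t) _ t< with s≤s t<k ← subst (suc t <_) (j+[1+k∸j] j≤k) t< = sym (h t t<k)

blocksᶻ : ∀ {n} → Fin n → ℤ → Word n → List (Word n)
blocksᶻ i (+ k) = blocks i minus (λ t → + t) k
blocksᶻ i -[1+ k ] = blocks i plus (λ t → ℤ.- (+ t)) (suc k)

∈-blocksᶻ⁻ : ∀ {n} (i : Fin n) m {v u} → u ∈ blocksᶻ i m v → Δxm i m v u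
∈-blocksᶻ⁻ i (+ k) = ∈-blocks⁻ i minus (λ t → + t) k _
∈-blocksᶻ⁻ i -[1+ k ] = ∈-blocks⁻ i plus (λ t → ℤ.- (+ t)) (suc k) _

∈-blocksᶻ⁺ : ∀ {n} (i : Fin n) m {v u} → Δxm i m v u → u ∈ blocksᶻ i m v
∈-blocksᶻ⁺ i (+ k) = ∈-blocks⁺ i minus (λ t → + t) k _
∈-blocksᶻ⁺ i -[1+ k ] = ∈-blocks⁺ i plus (λ t → ℤ.- (+ t)) (suc k) _

Δ-from : ∀ {n} → Word n → List (Word n)
Δ-from (var i m ∷ v) = blocksᶻ i m v
Δ-from _ = []

module _ {n} (ε : Equation n) where

  finals : List (Word n)
  finals = concatMap (suffixes ∘ embed) (toList ε)

  ∈-finals⁺ : ∀ {u} → FS ε u → u ∈ finals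
  ∈-finals⁺ f = ∈-concatMap⁺ (suffixes ∘ embed) (Any.map (λ { (v , eq) → subst (λ w → _ ∈ suffixes w) (sym eq) (∈-suffixes⁺ v) }) f)

  ∈-finals⁻ : ∀ {u} → u ∈ finals → FS ε u
  ∈-finals⁻ p = Any.map (λ {w} → ∈-suffixes⁻ (embed w)) (∈-concatMap⁻ (suffixes ∘ embed) p)

  FS-tail : ∀ {l u} → FS ε (l ∷ u) → FS ε u
  FS-tail {l} {u} = Any.map λ { (v , eq) → v ++ l ∷ [] , trans eq (sym (List.++-assoc v (l ∷ []) u)) }

  ΔList : List (Word n)
  ΔList = [] ∷ concatMap Δ-from finals

  ∈-ΔList⁻ : ∀ {u} → u ∈ ΔList → InΔ ε u
  ∈-ΔList⁻ (here refl) = inj₁ refl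
  ∈-ΔList⁻ {u} (there p) with find (∈-concatMap⁻ Δ-from {xs = finals} p)
  ... | var i m ∷ v , w∈ , u∈ =
    inj₂ (i , m , v , FS-tail (∈-finals⁻ w∈) , ∈-finals⁻ w∈ , ∈-blocksᶻ⁻ i m u∈)

  ∈-ΔList⁺ : ∀ {u} → InΔ ε u → u ∈ ΔList
  ∈-ΔList⁺ (inj₁ refl) = here refl
  ∈-ΔList⁺ (inj₂ (i , m , v , _ , f , d)) =
    there (∈-concatMap⁺ Δ-from (lose (∈-finals⁺ f) (∈-blocksᶻ⁺ i m d)))

  Δ-intro : ∀ {i m v u} → FS ε (var i m ∷ v) → Δxm i m v u → InΔ ε u
  Δ-intro f d = inj₂ (_ , _ , _ , FS-tail f , f , d)

-- Closure of Δ under the words that witness the adjunctions.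

resign : ℕ → Bool → (ℕ → Bool) → ℕ → Bool
resign zero x σ zero = false
resign zero x σ (suc zero) = x
resign zero x σ (suc (suc t)) = σ (suc (suc t))
resign (suc j) x σ zero = false
resign (suc j) x σ (suc t) = resign j x (σ ∘ suc) t

resign-0 : ∀ j x σ → resign j x σ 0 ≡ false
resign-0 zero x σ = refl
resign-0 (suc j) x σ = refl

resign-j : ∀ j x σ → resign j x σ j ≡ false
resign-j zero x σ = refl
resign-j (suc j) x σ = resign-j j x (σ ∘ suc)

resign-suc-j : ∀ j x σ → resign j x σ (suc j) ≡ x
resign-suc-j zero x σ = refl
resign-suc-j (suc j) x σ = resign-suc-j j x (σ ∘ suc)

resign-> : ∀ j x σ t → suc j < t → resign j x σ t ≡ σ t
resign-> zero x σ (suc zero) (s≤s ())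
resign-> zero x σ (suc (suc t)) _ = refl
resign-> (suc j) x σ (suc t) (s≤s p) = resign-> j x (σ ∘ suc) t p

module _ {n} (i : Fin n) (s : Letter n) (e : ℕ → ℤ) where

  block-plain : ∀ σ j c → σ j ≡ false → block i s e σ j (suc c) ≡ var i (e j) ∷ block i s e σ (suc j) c
  block-plain σ j c eq rewrite eq = refl

  block-signed : ∀ σ j c → σ j ≡ true → block i s e σ j (suc c) ≡ s ∷ var i (e j) ∷ block i s e σ (suc j) c
  block-signed σ j c eq rewrite eq = refl

  block-resign : ∀ j x σ c → block i s e (resign j x σ) (suc (suc j)) c ≡ block i s e σ (suc (suc j)) c
  block-resign j x σ c = block-cong i s e (suc (suc j)) c λ t p _ → resign-> j x σ t p

  -- A block that starts unsigned at index `j + 1` may receive a sign there and may be extended to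
  -- index `j`, with or without that sign.
  block-descend : ∀ {k v j σ b} → suc j ≤ k → σ (suc j) ≡ false → b ≡ block i s e σ (suc j) (suc (k ∸ suc j)) ++ v →
    ΔBlock i s e k v (s ∷ b) × ΔBlock i s e k v (var i (e j) ∷ b) × ΔBlock i s e k v (var i (e j) ∷ s ∷ b)
  block-descend {k} {v} {j} {σ} {b} j<k eq refl =
    inj₂ (suc j , τ true , j<k , resign-0 j true σ , cong (_++ v) (sym signed)) ,
    inj₂ (j , τ false , ℕ.<⇒≤ j<k , resign-0 j false σ , cong (_++ v) (sym (extend false plain))) ,
    inj₂ (j , τ true , ℕ.<⇒≤ j<k , resign-0 j true σ , cong (_++ v) (sym (extend true signed)))
    where
    c = k ∸ suc j
    -- No sign up to index `j`, `x` at `j + 1`, and `σ` beyond; in particular the sign of index 0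
    -- stays off.
    τ : Bool → ℕ → Bool
    τ x = resign j x σ
    b₀ = block i s e σ (suc j) (suc c)
    same : ∀ x → var i (e (suc j)) ∷ block i s e (τ x) (suc (suc j)) c ≡ b₀
    same x = trans (cong (var i (e (suc j)) ∷_) (block-resign j x σ c)) (sym (block-plain σ (suc j) c eq))
    plain : block i s e (τ false) (suc j) (suc c) ≡ b₀
    plain = trans (block-plain (τ false) (suc j) c (resign-suc-j j false σ)) (same false)
    signed : block i s e (τ true) (suc j) (suc c) ≡ s ∷ b₀
    signed = trans (block-signed (τ true) (suc j) c (resign-suc-j j true σ)) (cong (s ∷_) (same true))
    extend : ∀ x {w} → block i s e (τ x) (suc j) (suc c) ≡ w → block i s e (τ x) j (suc (k ∸ j)) ≡ var i (e j) ∷ w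
    extend x h = trans (cong (λ t → block i s e (τ x) j (suc t)) (ℕ.+-∸-assoc 1 j<k))
      (trans (block-plain (τ x) j (suc c) (resign-j j x σ)) (cong (var i (e j) ∷_) h))


  block-head : (∀ i′ m → var i′ m ≢ s) → ∀ {i′ m u} σ j c {v} → var i′ m ∷ u ≡ block i s e σ j (suc c) ++ v →
    σ j ≡ false × i′ ≡ i × e j ≡ m
  block-head s-sign σ j c eq with σ j
  ... | true = ⊥-elim (s-sign _ _ (List.∷-injectiveˡ eq))
  block-head s-sign σ j c refl | false = refl , refl , refl

module _ {n} (ε : Equation n) where

  private
    pos : ℕ → ℤ
    pos t = + t
    neg : ℕ → ℤ
    neg t = ℤ.- (+ t)

    singleton : ∀ {i : Fin n} {s e} k u → var i (e k) ∷ u ≡ block i s e (λ _ → false) k (suc (k ∸ k)) ++ u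
    singleton {i} {s} {e} k u rewrite ℕ.n∸n≡0 k = refl

    Δ-map₃ : ∀ {i m v u₁ u₂ u₃} → FS ε (var i m ∷ v) → Δxm i m v u₁ × Δxm i m v u₂ × Δxm i m v u₃ →
      InΔ ε u₁ × InΔ ε u₂ × InΔ ε u₃
    Δ-map₃ f (d₁ , d₂ , d₃) = Δ-intro ε f d₁ , Δ-intro ε f d₂ , Δ-intro ε f d₃

    neg≡- : ∀ j p → neg j ≡ -[1+ p ] → j ≡ suc p
    neg≡- (suc j) p eq = cong suc (ℤ.-[1+-injective eq)

    neg≢+ : ∀ j p → neg j ≢ + suc p
    neg≢+ zero p ()
    neg≢+ (suc j) p ()

  FS⇒Δ : ∀ w → FS ε (embed w) → InΔ ε (embed w)
  FS⇒Δ [] f = inj₁ refl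
  FS⇒Δ ((i , + k) ∷ w) f = Δ-intro ε f
    (inj₂ (k , (λ _ → false) , ℕ.≤-refl , refl , singleton {s = minus} {pos} k (embed w)))
  FS⇒Δ ((i , -[1+ k ]) ∷ w) f = Δ-intro ε f
    (inj₂ (suc k , (λ _ → false) , ℕ.≤-refl , refl , singleton {s = plus} {neg} (suc k) (embed w)))

  module _ {i : Fin n} {u : Word n} (p : ℕ) where

    -- Either `b` is itself a final subword and generates its own block, or it starts inside a
    -- block, which extends downwards. A block of exponents at most 0 cannot start with a positive
    -- one.
    Δ-minus : let b = var i (+ suc p) ∷ u in InΔ ε b →
      InΔ ε (minus ∷ b) × InΔ ε (var i (pos p) ∷ b) × InΔ ε (var i (pos p) ∷ minus ∷ b)
    Δ-minus (inj₂ (i′ , m , v , fv , f , d)) = cases m f d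
      where
      b = var i (+ suc p) ∷ u
      final : FS ε b → InΔ ε (minus ∷ b) × InΔ ε (var i (pos p) ∷ b) × InΔ ε (var i (pos p) ∷ minus ∷ b)
      final fb = Δ-map₃ fb (block-descend i minus pos {σ = λ _ → false} ℕ.≤-refl refl (singleton {s = minus} {pos} (suc p) u))
      cases : ∀ m → FS ε (var i′ m ∷ v) → Δxm i′ m v b →
        InΔ ε (minus ∷ b) × InΔ ε (var i (pos p) ∷ b) × InΔ ε (var i (pos p) ∷ minus ∷ b)
      cases (+ k) f (inj₁ refl) = final fv
      cases -[1+ k ] f (inj₁ refl) = final fv
      cases (+ k) f (inj₂ (j , σ , j≤k , _ , eq)) with block-head i′ minus pos (λ _ _ ()) σ j (k ∸ j) eq
      ... | σj , refl , refl = Δ-map₃ f (block-descend i minus pos j≤k σj eq)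
      cases -[1+ k ] f (inj₂ (j , σ , j≤k , _ , eq)) =
        ⊥-elim (neg≢+ j p (proj₂ (proj₂ (block-head i′ plus neg (λ _ _ ()) σ j (suc k ∸ j) eq))))

    Δ-plus : let b = var i -[1+ p ] ∷ u in InΔ ε b →
      InΔ ε (plus ∷ b) × InΔ ε (var i (neg p) ∷ b) × InΔ ε (var i (neg p) ∷ plus ∷ b)
    Δ-plus (inj₂ (i′ , m , v , fv , f , d)) = cases m f d
      where
      b = var i -[1+ p ] ∷ u
      final : FS ε b → InΔ ε (plus ∷ b) × InΔ ε (var i (neg p) ∷ b) × InΔ ε (var i (neg p) ∷ plus ∷ b)
      final fb = Δ-map₃ fb (block-descend i plus neg {σ = λ _ → false} ℕ.≤-refl refl (singleton {s = plus} {neg} (suc p) u))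
      cases : ∀ m → FS ε (var i′ m ∷ v) → Δxm i′ m v b →
        InΔ ε (plus ∷ b) × InΔ ε (var i (neg p) ∷ b) × InΔ ε (var i (neg p) ∷ plus ∷ b)
      cases (+ k) f (inj₁ refl) = final fv
      cases -[1+ k ] f (inj₁ refl) = final fv
      cases -[1+ k ] f (inj₂ (j , σ , j≤k , _ , eq)) with block-head i′ plus neg (λ _ _ ()) σ j (suc k ∸ j) eq
      ... | σj , refl , ej with refl ← neg≡- j p ej = Δ-map₃ f (block-descend i plus neg j≤k σj eq)
      cases (+ k) f (inj₂ (j , σ , j≤k , _ , eq)) with block-head i′ minus pos (λ _ _ ()) σ j (k ∸ j) eq
      ... | _ , _ , ()

-- A decidable certificate for compatible surjections.

_≟ᴸ_ : ∀ {n} → DecidableEquality (Letter n)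
var i m ≟ᴸ var j k = map′ (λ { (refl , refl) → refl }) (λ { refl → refl , refl }) (i Fin.≟ j ×-dec m ℤ.≟ k)
var i m ≟ᴸ plus = no λ ()
var i m ≟ᴸ minus = no λ ()
plus ≟ᴸ var i m = no λ ()
plus ≟ᴸ plus = yes refl
plus ≟ᴸ minus = no λ ()
minus ≟ᴸ var i m = no λ ()
minus ≟ᴸ plus = no λ ()
minus ≟ᴸ minus = yes refl

_≟ʷ_ : ∀ {n} → DecidableEquality (Word n)
_≟ʷ_ = List.≡-dec _≟ᴸ_

module _ {n} (ε : Equation n) where

  private
    ws : List (Word n)
    ws = ΔList ε

    infix 4 _∈?_
    _∈?_ : ∀ u vs → Dec (u ∈ vs)
    _∈?_ = DecMembership._∈?_ (_≟ʷ_ {n})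

  -- For a nonzero exponent this is one unfolding of the inverse relation, tested at the words
  -- supplied by `Δ-minus` or `Δ-plus` instead of at existentially quantified points. All conditions
  -- are therefore decidable.
  LocallyCompatible : (Word n → ℕ) → Word n → Set
  LocallyCompatible φ [] = ⊤
  LocallyCompatible φ (plus ∷ u) = u ∈ ws → φ (plus ∷ u) ≡ suc (φ u)
  LocallyCompatible φ (minus ∷ u) = u ∈ ws → φ u ≡ suc (φ (minus ∷ u))
  LocallyCompatible φ (var i (+ zero) ∷ u) = u ∈ ws →
    All (λ v → var i (+ 0) ∷ v ∈ ws → φ u ≤ φ v → φ (var i (+ 0) ∷ u) ≤ φ (var i (+ 0) ∷ v)) ws
  LocallyCompatible φ (var i (+ suc p) ∷ u) = u ∈ ws →
    φ (var i (+ p) ∷ minus ∷ var i (+ suc p) ∷ u) < φ u × φ u ≤ φ (var i (+ p) ∷ var i (+ suc p) ∷ u)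
  LocallyCompatible φ (var i -[1+ p ] ∷ u) = u ∈ ws →
    φ (var i (ℤ.- (+ p)) ∷ var i -[1+ p ] ∷ u) ≤ φ u × φ u < φ (var i (ℤ.- (+ p)) ∷ plus ∷ var i -[1+ p ] ∷ u)

  locallyCompatible? : ∀ φ u → Dec (LocallyCompatible φ u)
  locallyCompatible? φ [] = yes tt
  locallyCompatible? φ (plus ∷ u) = u ∈? ws →-dec (_ ℕ.≟ _)
  locallyCompatible? φ (minus ∷ u) = u ∈? ws →-dec (_ ℕ.≟ _)
  locallyCompatible? φ (var i (+ zero) ∷ u) = u ∈? ws →-dec
    All.all? (λ v → var i (+ 0) ∷ v ∈? ws →-dec (_ ℕ.≤? _ →-dec _ ℕ.≤? _)) ws
  locallyCompatible? φ (var i (+ suc p) ∷ u) = u ∈? ws →-dec (_ ℕ.<? _ ×-dec _ ℕ.≤? _)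
  locallyCompatible? φ (var i -[1+ p ] ∷ u) = u ∈? ws →-dec (_ ℕ.≤? _ ×-dec _ ℕ.<? _)

  record Solution (q : ℕ) (φ : Word n → ℕ) : Set where
    constructor solution
    field
      range : All (λ u → 1 ≤ φ u × φ u ≤ q) ws
      hit   : All (λ k → Any (λ u → φ u ≡ suc k) ws) (upTo q)
      local : All (LocallyCompatible φ) ws
      fails : FailsIn ε q φ

  solution? : ∀ q φ → Dec (Solution q φ)
  solution? q φ = map′ (λ (a , b , c , d) → solution a b c d) (λ (solution a b c d) → a , b , c , d)
    (All.all? (λ u → 1 ℕ.≤? φ u ×-dec φ u ℕ.≤? q) ws ×-dec
     All.all? (λ k → Any.any? (λ u → φ u ℕ.≟ suc k) ws) (upTo q) ×-dec
     All.all? (locallyCompatible? φ) ws ×-dec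
     All.all? (λ w → φ (embed w) ℕ.<? φ []) (toList ε))

  module _ {q : ℕ} {φ : Word n → ℕ} (sol : Solution q φ) where
    open Solution sol

    private
      at : ∀ {u} → InΔ ε u → LocallyCompatible φ u
      at d = All.lookup local (∈-ΔList⁺ ε d)

      cover : ∀ {a b} → ⋖Rel ε q φ a b → b ≡ suc a
      cover (inj₁ (v , dv , d , refl , refl)) = at d (∈-ΔList⁺ ε dv)
      cover (inj₂ (v , dv , d , refl , refl)) = at d (∈-ΔList⁺ ε dv)

      monotone : ∀ i {a a′ b b′} → gRel ε q φ i a b → gRel ε q φ i a′ b′ → a ≤ a′ → b ≤ b′
      monotone i (u , du , dxu , refl , refl) (v , dv , dxv , refl , refl) =
        All.lookup (at dxu (∈-ΔList⁺ ε du)) (∈-ΔList⁺ ε dv) (∈-ΔList⁺ ε dxv)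

      -- Induction on the exponent: with `b` for the word of exponent `p + 1`, the covering pair
      -- comes from `minus ∷ b` and `b`, and the induction hypothesis gives the values of the
      -- relation of exponent `p` there.
      adjL : ∀ i p u → InΔ ε u → InΔ ε (var i (+ p) ∷ u) →
        iterL (⋖Rel ε q φ) (gRel ε q φ i) p (φ u) (φ (var i (+ p) ∷ u))
      adjL i zero u du d = u , du , d , refl , refl
      adjL i (suc p) u du d with dm , dx , dxm ← Δ-minus ε p d with lt , le ← at d (∈-ΔList⁺ ε du) =
        _ , _ , _ , adjL i p _ dm dxm , adjL i p _ d dx , inj₂ (_ , d , dm , refl , refl) , lt , le

      adjR : ∀ i p u → InΔ ε u → InΔ ε (var i (ℤ.- (+ p)) ∷ u) →
        iterR (⋖Rel ε q φ) (gRel ε q φ i) p (φ u) (φ (var i (ℤ.- (+ p)) ∷ u))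
      adjR i zero u du d = u , du , d , refl , refl
      adjR i (suc p) u du d with dp , dx , dxp ← Δ-plus ε p d with le , lt ← at d (∈-ΔList⁺ ε du) =
        _ , _ , _ , adjR i p _ d dx , adjR i p _ dp dxp , inj₁ (_ , d , dp , refl , refl) , le , lt

    solution-compatible : IsCompatibleSurjection ε q φ
    solution-compatible = record
      { into = λ u d → All.lookup range (∈-ΔList⁺ ε d)
      ; onto = λ { (suc k) _ k<q → let u , u∈ , eq = find (All.lookup hit (∈-upTo⁺ k<q)) in u , ∈-ΔList⁻ ε u∈ , eq }
      ; g-opf = λ i →
          (λ { r@(_ , _ , _ , refl , _) r′@(_ , _ , _ , eq , _) →
            ℕ.≤-antisym (monotone i r r′ ℕ.≤-refl) (monotone i r′ r ℕ.≤-refl) }) ,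
          monotone i
      ; ⋖-cov = cover
      ; adj = λ { i (+ p) → adjL i p ; i -[1+ p ] → adjR i (suc p) }
      }

-- From an order on words to a certificate.

record WordOrder (c : Level) {n : ℕ} (ε : Equation n) : Set (Level.suc c) where
  infix 4 _⊑_ _⊏_
  field
    _⊑_ _⊏_      : Word n → Word n → Set c
    ⊑-refl       : ∀ s → s ⊑ s
    acyclic      : ∀ {s t r} → s ⊑ t → t ⊑ r → ¬ r ⊏ s
    ⊏-asym       : ∀ {s t} → s ⊏ t → ¬ t ⊏ s
    compare      : ∀ {s t} → s ∈ ΔList ε → t ∈ ΔList ε → s ⊑ t ⊎ t ⊏ s
    ⊏-plus       : ∀ s → s ⊏ plus ∷ s
    plus-next    : ∀ {s t} → s ⊏ t → ¬ t ⊏ plus ∷ s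
    minus-⊏      : ∀ s → minus ∷ s ⊏ s
    minus-next   : ∀ {s t} → minus ∷ s ⊏ t → ¬ t ⊏ s
    var-mono     : ∀ i m {s t} → s ⊑ t → var i m ∷ s ⊑ var i m ∷ t
    ℓ-expand     : ∀ i p s → s ⊑ var i (+ p) ∷ var i (+ suc p) ∷ s
    ℓ-minus      : ∀ i p s → var i (+ p) ∷ minus ∷ var i (+ suc p) ∷ s ⊏ s
    r-contract   : ∀ i p s → var i (ℤ.- (+ p)) ∷ var i -[1+ p ] ∷ s ⊑ s
    r-plus       : ∀ i p s → s ⊏ var i (ℤ.- (+ p)) ∷ plus ∷ var i -[1+ p ] ∷ s
    words-⊏      : ∀ {w} → w ∈ toList ε → embed w ⊏ []

-- The choice of φ outside Δ is immaterial, so finitely many candidates suffice.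
candidates : ∀ {n} → Equation n → List (ℕ × (Word n → ℕ))
candidates ε = cartesianProduct (upTo (suc N)) (assignments _≟ʷ_ ws N)
  where
  ws = ΔList ε
  N = length (allFin (length ws))

module _ {c : Level} {n : ℕ} {ε : Equation n} (O : WordOrder c ε) where
  open WordOrder O

  private
    ws : List (Word n)
    ws = ΔList ε

    _≼_ : Fin (length ws) → Fin (length ws) → Set c
    i ≼ j = lookup ws i ⊑ lookup ws j

    compareᶠ : ∀ i j → lookup ws i ⊑ lookup ws j ⊎ lookup ws j ⊏ lookup ws i
    compareᶠ i j = compare (∈-lookup i) (∈-lookup j)

    -- Transitivity is not assumed of `⊑`; for words of Δ the other alternative of `compare` would
    -- close a forbidden cycle.
    ≼-trans : ∀ {i j k} → i ≼ j → j ≼ k → i ≼ k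
    ≼-trans {i} {j} {k} p q with compareᶠ i k
    ... | inj₁ r = r
    ... | inj₂ r = ⊥-elim (acyclic p q r)

    ≼-total : ∀ i j → i ≼ j ⊎ j ≼ i
    ≼-total i j with compareᶠ i j | compareᶠ j i
    ... | inj₁ p | _ = inj₁ p
    ... | inj₂ _ | inj₁ q = inj₂ q
    ... | inj₂ p | inj₂ q = ⊥-elim (⊏-asym p q)

    _≼?_ : ∀ i j → Dec (i ≼ j)
    i ≼? j with compareᶠ i j
    ... | inj₁ p = yes p
    ... | inj₂ q = no λ p → acyclic p (⊑-refl _) q

    N : ℕ
    N = length (allFin (length ws))

  module _ (R : Ranking _≼_ N) where
    open Ranking R

    -- A word may occur several times in `ws`, so its rank is taken at some occurrence; `φ-lookup`
    -- shows that the choice does not matter.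
    IsRank : Word n → ℕ → Set
    IsRank u k = ∃ λ (p : u ∈ ws) → k ≡ rank (index p)

    ranked : All (λ u → ∃ λ k → k ≤ N × IsRank u k) ws
    ranked = All.tabulate λ p → rank (index p) , ℕ.≤-trans (rank≤size (index p)) size≤ , p , refl

    module _ {φ : Word n → ℕ} (φ-rank : All (λ u → IsRank u (φ u)) ws) where

      φ-mono : ∀ {s t} → s ∈ ws → t ∈ ws → s ⊑ t → φ s ≤ φ t
      φ-mono s∈ t∈ h with p , eq ← All.lookup φ-rank s∈ | q , eq′ ← All.lookup φ-rank t∈ =
        subst₂ _≤_ (sym eq) (sym eq′) (rank-mono {index p} {index q} (subst₂ _⊑_ (Any.lookup-index p) (Any.lookup-index q) h))

      φ-cancel : ∀ {s t} → s ∈ ws → t ∈ ws → φ s ≤ φ t → s ⊑ t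
      φ-cancel s∈ t∈ h with p , eq ← All.lookup φ-rank s∈ | q , eq′ ← All.lookup φ-rank t∈ =
        subst₂ _⊑_ (sym (Any.lookup-index p)) (sym (Any.lookup-index q))
          (rank-cancel {index p} {index q} (subst₂ _≤_ eq eq′ h))

      φ-strict : ∀ {s t} → s ∈ ws → t ∈ ws → s ⊏ t → φ s < φ t
      φ-strict s∈ t∈ h = ℕ.≰⇒> λ le → acyclic (φ-cancel t∈ s∈ le) (⊑-refl _) h

      φ-strict⁻ : ∀ {s t} → s ∈ ws → t ∈ ws → φ s < φ t → s ⊏ t
      φ-strict⁻ s∈ t∈ lt with compare t∈ s∈
      ... | inj₁ h = ⊥-elim (ℕ.<⇒≱ lt (φ-mono t∈ s∈ h))
      ... | inj₂ h = h

      φ-range : All (λ u → 1 ≤ φ u × φ u ≤ size) ws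
      φ-range = All.map
        (λ { (p , eq) → subst (1 ≤_) (sym eq) (rank-pos (index p)) , subst (_≤ size) (sym eq) (rank≤size (index p)) }) φ-rank

      φ-lookup : ∀ i → φ (lookup ws i) ≡ rank i
      φ-lookup i with p , eq ← All.lookup φ-rank (∈-lookup {xs = ws} i) = trans eq (ℕ.≤-antisym
        (rank-mono {index p} {i} (subst (_⊑ lookup ws i) (Any.lookup-index p) (⊑-refl _)))
        (rank-mono {i} {index p} (subst (lookup ws i ⊑_) (Any.lookup-index p) (⊑-refl _))))

      φ-hit : ∀ {k} → k < size → Any (λ u → φ u ≡ suc k) ws
      φ-hit {k} k<q with i , eq ← rank-onto k k<q = lose (∈-lookup i) (trans (φ-lookup i) eq)

      -- Every rank up to `size` is attained, so a gap between the values would yield a word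
      -- strictly between `s` and `t`.
      φ-cover : ∀ {s t} → s ∈ ws → t ∈ ws → s ⊏ t → (∀ {r} → s ⊏ r → ¬ r ⊏ t) → φ t ≡ suc (φ s)
      φ-cover {s} {t} s∈ t∈ s⊏t next with ℕ.m≤n⇒m<n∨m≡n (φ-strict s∈ t∈ s⊏t)
      ... | inj₂ eq = sym eq
      ... | inj₁ gap
        with r , r∈ , φr ← find (φ-hit (ℕ.<-≤-trans (ℕ.<-trans (ℕ.n<1+n _) gap) (proj₂ (All.lookup φ-range t∈)))) =
        ⊥-elim (next (φ-strict⁻ s∈ r∈ (ℕ.≤-reflexive (sym φr))) (φ-strict⁻ r∈ t∈ (subst (_< φ t) (sym φr) gap)))

      φ-local : ∀ u → u ∈ ws → LocallyCompatible ε φ u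
      φ-local [] _ = tt
      φ-local (plus ∷ u) d u∈ = φ-cover u∈ d (⊏-plus u) plus-next
      φ-local (minus ∷ u) d u∈ = φ-cover d u∈ (minus-⊏ u) minus-next
      φ-local (var i (+ zero) ∷ u) d u∈ = All.tabulate λ t∈ xt∈ le →
        φ-mono d xt∈ (var-mono i (+ 0) (φ-cancel u∈ t∈ le))
      φ-local (var i (+ suc p) ∷ u) d u∈ with _ , dx , dxm ← Δ-minus ε p (∈-ΔList⁻ ε d) =
        φ-strict (∈-ΔList⁺ ε dxm) u∈ (ℓ-minus i p u) , φ-mono u∈ (∈-ΔList⁺ ε dx) (ℓ-expand i p u)
      φ-local (var i -[1+ p ] ∷ u) d u∈ with _ , dx , dxp ← Δ-plus ε p (∈-ΔList⁻ ε d) =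
        φ-mono (∈-ΔList⁺ ε dx) u∈ (r-contract i p u) , φ-strict u∈ (∈-ΔList⁺ ε dxp) (r-plus i p u)

      φ-fails : FailsIn ε size φ
      φ-fails = All.tabulate λ {w} w∈ →
        φ-strict (∈-ΔList⁺ ε (FS⇒Δ ε w (lose w∈ ([] , refl)))) (here refl) (words-⊏ w∈)

      φ-solution : Solution ε size φ
      φ-solution = solution φ-range (All.tabulate λ k∈ → φ-hit (∈-upTo⁻ k∈)) (All.tabulate (φ-local _)) φ-fails

    ranking-solvable : Any (λ (q , φ) → Solution ε q φ) (candidates ε)
    ranking-solvable = Any.cartesianProductWith⁺ _,_ {P = size ≡_}
      (λ { refl rk → φ-solution rk }) (∈-upTo⁺ (s≤s size≤)) (assignments-complete _≟ʷ_ IsRank N ws ranked)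

  solvable : Any (λ (q , φ) → Solution ε q φ) (candidates ε)
  solvable = ranking-solvable
    (ranking _≼_ (λ {i} {j} {k} → ≼-trans {i} {j} {k}) ≼-total _≼?_ (allFin (length ws)) ∈-allFin)

-- Interpretation of words in a pregroup refuting the equation.

module _ {c : Level} {n : ℕ} (ε : Equation n) (A : DLPG c) (val : Fin n → DLPG.Carrier A) where
  open DLPG A using (Carrier; _≤ᴬ_; _∨_; _·_; 𝟙)
  open Pregroup A

  ⟦_⟧ : Word n → Point
  ⟦ [] ⟧ = 𝟙 , + 0
  ⟦ plus ∷ w ⟧ = up ⟦ w ⟧
  ⟦ minus ∷ w ⟧ = down ⟦ w ⟧
  ⟦ var i m ∷ w ⟧ = act (val i) m ⟦ w ⟧

  -- Without `plus` and `minus` the level stays 0, where `act` leaves the exponent unchanged.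
  ⟦embed⟧ : ∀ w → ⟦ embed w ⟧ ≡ (evalWord A val w , + 0)
  ⟦embed⟧ [] = refl
  ⟦embed⟧ ((i , m) ∷ w) = trans (cong (act (val i) m) (⟦embed⟧ w))
    (cong (λ k → pow A k (val i) · evalWord A val w , + 0) (ℤ.+-identityʳ m))

  join : Equation n → Carrier
  join η = foldr₁ _∨_ (map⁺ (evalWord A val) η)

  eval≤join : ∀ w ws → All (λ t → evalWord A val t ≤ᴬ join (w ∷⁺ ws)) (w ∷ ws)
  eval≤join w [] = ≤-refl ∷ []
  eval≤join w (t ∷ ts) = x≤x∨y _ _ ∷ All.map (λ p → ≤-trans p (y≤x∨y _ _)) (eval≤join t ts)

  suc-neg : ∀ p → ℤ.suc -[1+ p ] ≡ ℤ.- (+ p)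
  suc-neg zero = refl
  suc-neg (suc p) = refl

  wordOrder : ∀ {v} → join ε ≤ᴬ v → Consistent v →
    (∀ {s t} → s ∈ ΔList ε → t ∈ ΔList ε → Decided v (⟦ s ⟧ , ⟦ t ⟧)) → WordOrder c ε
  wordOrder {v} join≤v con decided = record
    { _⊑_ = λ s t → v ⊢ ⟦ s ⟧ ⊑ ⟦ t ⟧
    ; _⊏_ = λ s t → v ⊢ up ⟦ s ⟧ ⊑ ⟦ t ⟧
    ; ⊑-refl = λ s → ⊑-refl ⟦ s ⟧
    ; acyclic = λ {s} {t} {r} → ⊑-acyclic con ⟦ s ⟧ ⟦ t ⟧ ⟦ r ⟧
    ; ⊏-asym = λ {s} {t} p q → ⊑-acyclic con ⟦ s ⟧ (up ⟦ s ⟧) ⟦ t ⟧ (⊑-up ⟦ s ⟧) p q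
    ; compare = decided
    ; ⊏-plus = λ s → ⊑-refl (up ⟦ s ⟧)
    ; plus-next = λ {s} {t} p q → ⊑-acyclic con (up ⟦ s ⟧) ⟦ t ⟧ ⟦ t ⟧ p (⊑-refl ⟦ t ⟧) q
    ; minus-⊏ = λ s → subst (v ⊢_⊑ ⟦ s ⟧) (sym (up-down ⟦ s ⟧)) (⊑-refl ⟦ s ⟧)
    ; minus-next = λ {s} {t} p q →
        ⊑-acyclic con ⟦ s ⟧ ⟦ t ⟧ ⟦ t ⟧ (subst (v ⊢_⊑ ⟦ t ⟧) (up-down ⟦ s ⟧) p) (⊑-refl ⟦ t ⟧) q
    ; var-mono = λ i m {s} {t} → act-mono (val i) m ⟦ s ⟧ ⟦ t ⟧
    ; ℓ-expand = λ i p s → act-suc-expand (val i) (+ p) ⟦ s ⟧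
    ; ℓ-minus = λ i p s → act-down-< (val i) (+ p) ⟦ s ⟧
    ; r-contract = λ i p s →
        subst (λ m → v ⊢ act (val i) m (act (val i) -[1+ p ] ⟦ s ⟧) ⊑ ⟦ s ⟧) (suc-neg p)
          (act-suc-contract (val i) -[1+ p ] ⟦ s ⟧)
    ; r-plus = λ i p s →
        subst (λ m → v ⊢ up ⟦ s ⟧ ⊑ act (val i) m (up (act (val i) -[1+ p ] ⟦ s ⟧))) (suc-neg p)
          (act-up-> (val i) -[1+ p ] ⟦ s ⟧)
    -- The level difference is -1, so a path with a single edge to `𝟙` is required; it exists
    -- because the value of `w` lies below `join ε`, hence below `v`.
    ; words-⊏ = λ {w} w∈ →
        subst (λ p → v ⊢ up p ⊑ ⟦ [] ⟧) (sym (⟦embed⟧ w)) (𝟙 , below (All.lookup (eval≤join _ _) w∈) , refl)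
    }
    where
    below : ∀ {x} → x ≤ᴬ join ε → Edge v x 𝟙
    below {x} p = ≤-trans (·-contractˡ x (≤-reflexive (sym 𝟙ʳ))) (≤-trans p join≤v)

  -- Comparisons in A are undecidable, so a solution is only found up to double negation; the finite
  -- search over candidates removes it.
  solvable-¬¬ : ¬ HoldsIn A ε val → ¬ ¬ Any (λ (q , φ) → Solution ε q φ) (candidates ε)
  solvable-¬¬ ¬holds k =
    ⊑-decide-all ¬holds (cartesianProductWith (λ s t → ⟦ s ⟧ , ⟦ t ⟧) (ΔList ε) (ΔList ε)) λ (v , j≤v , con , ds) →
    k (solvable (wordOrder j≤v con λ s∈ t∈ → All.lookup ds (∈-cartesianProductWith⁺ (λ s t → ⟦ s ⟧ , ⟦ t ⟧) s∈ t∈)))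

theorem3p5 : ∀ {c : Level} {n : ℕ} (ε : Equation n) →
    (A : DLPG c) (val : Fin n → DLPG.Carrier A) → ¬ HoldsIn A ε val →
    Σ ℕ λ q → Σ (Word n → ℕ) λ φ →
    IsCompatibleSurjection ε q φ × FailsIn ε q φ
theorem3p5 ε A val ¬holds = fromSolution
  (decidable-stable (Any.any? (λ (q , φ) → solution? ε q φ) (candidates ε)) (solvable-¬¬ ε A val ¬holds))
  where
  fromSolution : ∀ {qφs : List (ℕ × (Word _ → ℕ))} → Any (λ (q , φ) → Solution ε q φ) qφs →
    Σ ℕ λ q → Σ (Word _ → ℕ) λ φ → IsCompatibleSurjection ε q φ × FailsIn ε q φ
  fromSolution any with (q , φ) , _ , sol ← find any = q , φ , solution-compatible ε sol , Solution.fails sol
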